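{- For every integer $n\ge 1$, $$A_n(t,1,q)=\sum_{k=0}^{\lfloor (n-1)/2\rfloor}\Bigl(\sum_{\sigma\in\mathfrak{D}_{n,k}} q^{\mathrm{inv}(\sigma)}\Bigr)\, t^k(1+t)^{n-1-2k}.$$
   Context: $\mathfrak{S}_n$ is the set of permutations $\sigma=\sigma_1\cdots\sigma_n$ of $[n]=\{1,\dots,n\}$. For $\sigma\in\mathfrak{S}_n$: $\mathrm{exc}(\sigma)=|\{i:\sigma_i>i\}|$, $\mathrm{fix}(\sigma)=|\{i:\sigma_i=i\}|$, $\mathrm{maj}(\sigma)=\sum_{i:\sigma_i>\sigma_{i+1}} i$, $\mathrm{des}(\sigma)=|\{i\in[n-1]:\sigma_i>\sigma_{i+1}\}|$, and $\mathrm{inv}(\sigma)=|\{(i,j):1\le i<j\le n,\ \sigma_i>\sigma_j\}|$. The basic Eulerian polynomial is $A_n(t,r,q)=\sum_{\sigma\in\mathfrak{S}_n} t^{\mathrm{exc}(\sigma)}r^{\mathrm{fix}(\sigma)}q^{\mathrm{maj}(\sigma)-\mathrm{exc}(\sigma)}$. With the convention $\sigma_0=\sigma_{n+1}=+\infty$, the entry $\sigma_i$ ($1\le i\le n$) is a double descent if $\sigma_{i-1}>\sigma_i>\sigma_{i+1}$; $\mathrm{dd}(\sigma)$ is the number of double descents. $\mathfrak{D}_{n,k}=\{\sigma\in\mathfrak{S}_n:\mathrm{dd}(\sigma)=0,\ \mathrm{des}(\sigma)=k\}$. -}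

module Defs where

open import Level using (Level)
open import Data.Nat using (ℕ; zero; suc; _+_; _∸_; _<ᵇ_; _≡ᵇ_)
open import Data.Nat.DivMod using (_/_)
open import Data.Bool using (Bool; true; false; if_then_else_; _∧_; not)
open import Data.List using (List; []; _∷_; map; filter; concatMap; upTo; length; foldr)
open import Algebra.Bundles using (CommutativeRing)
open import Relation.Nullary.Decidable using (yes; no)
open import Relation.Unary using (Decidable)
open import Relation.Binary.PropositionalEquality using (_≡_)
open import Data.Bool using (T)
open import Data.Bool.Properties using (T?)

-- Permutations of [n] = {1,…,n}, written in one-line notation σ₁⋯σₙ as
-- lists of natural numbers.

words : ℕ → ℕ → List (List ℕ)
words n zero    = [] ∷ []
words n (suc m) = concatMap (λ a → map (a ∷_) (words n m)) (map suc (upTo n))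

notElem : ℕ → List ℕ → Bool
notElem a []       = true
notElem a (b ∷ bs) = not (a ≡ᵇ b) ∧ notElem a bs

distinct : List ℕ → Bool
distinct []       = true
distinct (a ∷ as) = notElem a as ∧ distinct as

-- 𝔖ₙ : the words of length n over [n] with distinct letters
-- (i.e. the injective, hence bijective, maps [n] → [n])
perms : ℕ → List (List ℕ)
perms n = filter (λ w → T? (distinct w)) (words n n)

b2n : Bool → ℕ
b2n true  = 1
b2n false = 0

excFrom : ℕ → List ℕ → ℕ
excFrom i []       = 0
excFrom i (a ∷ as) = b2n (i <ᵇ a) + excFrom (suc i) as

exc : List ℕ → ℕ
exc = excFrom 1

fixFrom : ℕ → List ℕ → ℕ
fixFrom i []       = 0
fixFrom i (a ∷ as) = b2n (i ≡ᵇ a) + fixFrom (suc i) as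

fix : List ℕ → ℕ
fix = fixFrom 1

majFrom : ℕ → List ℕ → ℕ
majFrom i []           = 0
majFrom i (a ∷ [])     = 0
majFrom i (a ∷ b ∷ as) = (if b <ᵇ a then i else 0) + majFrom (suc i) (b ∷ as)

maj : List ℕ → ℕ
maj = majFrom 1

des : List ℕ → ℕ
des []           = 0
des (a ∷ [])     = 0
des (a ∷ b ∷ as) = b2n (b <ᵇ a) + des (b ∷ as)

countLess : ℕ → List ℕ → ℕ
countLess a []       = 0
countLess a (b ∷ bs) = b2n (b <ᵇ a) + countLess a bs

inv : List ℕ → ℕ
inv []       = 0
inv (a ∷ as) = countLess a as + inv as

-- double descents with σ₀ = σₙ₊₁ = +∞.
-- A value of type Ext is either a finite entry or +∞.
data Ext : Set where
  fin : ℕ → Ext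
  ∞   : Ext

_<ᴱ_ : Ext → Ext → Bool
fin a <ᴱ fin b = a <ᵇ b
fin a <ᴱ ∞     = true
∞     <ᴱ _     = false

ddFrom : Ext → List ℕ → ℕ
ddFrom p []           = 0
ddFrom p (a ∷ [])     = b2n (fin a <ᴱ p ∧ ∞ <ᴱ fin a)   -- σₙ₊₁ = +∞ : never
ddFrom p (a ∷ b ∷ as) = b2n (fin a <ᴱ p ∧ fin b <ᴱ fin a) + ddFrom (fin a) (b ∷ as)

dd : List ℕ → ℕ
dd = ddFrom ∞

Dnk : ℕ → ℕ → List (List ℕ)
Dnk n k = filter (λ σ → T? ((dd σ ≡ᵇ 0) ∧ (des σ ≡ᵇ k))) (perms n)

-- Evaluation of the polynomials in an arbitrary commutative ring.
-- (An identity in ℤ[t,r,q] is equivalent to its validity in every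
-- commutative ring for all values of the variables.)

module _ {c ℓ : Level} (R : CommutativeRing c ℓ) where
  open CommutativeRing R renaming (_+_ to _⊕_; _*_ to _⊗_)

  pow : Carrier → ℕ → Carrier
  pow x zero    = 1#
  pow x (suc m) = x ⊗ pow x m

  sumR : List Carrier → Carrier
  sumR = foldr _⊕_ 0#

  -- A_n(t,r,q) = Σ_{σ∈𝔖ₙ} t^{exc σ} r^{fix σ} q^{maj σ - exc σ}
  -- (maj σ ≥ exc σ always holds, so ∸ is ordinary subtraction here)
  A : ℕ → Carrier → Carrier → Carrier → Carrier
  A n t r q = sumR (map (λ σ → pow t (exc σ) ⊗ pow r (fix σ) ⊗ pow q (maj σ ∸ exc σ)) (perms n))

  gammaSide : ℕ → Carrier → Carrier → Carrier
  gammaSide n t q =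
    sumR (map (λ k → sumR (map (λ σ → pow q (inv σ)) (Dnk n k))
                     ⊗ pow t k ⊗ pow (1# ⊕ t) (n ∸ 1 ∸ (k + k)))
              (upTo (suc ((n ∸ 1) / 2))))

{-# OPTIONS --safe #-}
module Submission where

-- Bar the excedances of σ and let barred letters be smaller than all others; then
-- maj σ - exc σ is the sum of the descents of the barred word.  In this form a permutation
-- arises from a derangement by inserting fixed points, which contributes a q-binomial
-- coefficient, both when fixed points stay unbarred and when they are barred.  Rotating the
-- values (a ↦ a + 1, n ↦ 1) turns weak excedances into excedances, so for n ≥ 1 both ways of
-- counting agree up to a factor t.  Writing f ⋆ g for the q-binomial convolution and d for the
-- derangement polynomials, this says d = ε + d ⋆ ω with ω₀ = 0, ωⱼ₊₁ = t (1 + ⋯ + tʲ⁻¹), while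
-- Aₙ = (d ⋆ 1)ₙ.
-- The weights tᵏ (1 + t)ⁿ⁻¹⁻²ᵏ of the permutations without double descents are produced by a
-- two-state automaton reading σ from left to right.  Cutting where it first returns to the initial
-- state from the other one shows that the γ-side G satisfies G = 1 + ω ⋆ G.  Hence
-- A = d ⋆ 1 = d ⋆ G - d ⋆ ω ⋆ G = G.

open import Algebra.Bundles using (CommutativeRing)
open import Data.Bool using (Bool; true; false; if_then_else_; T; not; _∧_)
open import Data.Bool.Properties using (T?; T-≡; T-∧)
open import Data.List
  using (List; []; _∷_; _++_; applyUpTo; _∷ʳ_; map; filter; concatMap; upTo; length; reverse; cartesianProduct)
open import Data.List.Membership.Propositional using (_∈_; find; lose)
open import Data.List.Membership.Propositional.Properties
open import Data.List.Membership.Propositional.Properties.WithK using (unique∧set⇒bag)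
open import Data.List.Properties
  using (length-map; length-++; unfold-reverse; reverse-injective; reverse-involutive; length-reverse;
    ∷-injectiveˡ; ∷-injectiveʳ; map-injective; map-upTo; map-∘; ++-assoc; map-cong-local)
open import Data.List.Relation.Binary.BagAndSetEquality using (∼bag⇒↭)
open import Data.List.Relation.Binary.Permutation.Propositional
  using (_↭_; ↭⇒↭ₛ; ↭-refl; ↭-sym; ↭-trans; ↭-reflexive; prep; swap; module PermutationReasoning)
open import Data.List.Relation.Binary.Permutation.Propositional.Properties
  using (map⁺; ↭-map-inv; ↭-length; ++⁺ˡ; shift; drop-∷; ↭-reverse; ∈-resp-↭; ¬x∷xs↭[]; ++-identityʳ)
open import Data.List.Relation.Unary.All as All using (All; []; _∷_)
open import Data.List.Relation.Unary.AllPairs using ([]; _∷_)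
open import Data.List.Relation.Unary.Any using (here; there)
open import Data.List.Relation.Unary.Unique.Propositional using (Unique)
open import Data.Nat using (ℕ; zero; suc; _+_; _*_; _∸_; _≤_; _<_; z≤n; s≤s; _<ᵇ_; _≡ᵇ_; _≤?_; _<?_; _≟_)
open import Data.Nat.DivMod using (_/_; /-monoˡ-≤; m*n/n≡m)
open import Data.Nat.Induction using (<-rec)
open import Data.Nat.Properties
open import Data.Nat.Tactic.RingSolver using () renaming (solve-∀ to ℕ-solve-∀)
open import Data.Product using (_×_; _,_; ∃; ∃₂; proj₁; proj₂)
open import Data.Sum using (_⊎_; inj₁; inj₂)
open import Data.Unit using (⊤; tt)
open import Defs
open import Function using (_∘_; id; Equivalence; case_of_)
open import Function.Bundles using (mk⇔)
open import Level using (Level)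
open import Relation.Binary.Definitions using (tri<; tri≈; tri>)
open import Relation.Binary.PropositionalEquality
  using (_≡_; _≢_; refl; sym; trans; cong; cong₂; subst; ≢-sym;
    module ≡-Reasoning) renaming (setoid to ≡-setoid)
open import Relation.Nullary using (Dec; yes; no; does; contradiction; ¬?; _×-dec_)
open import Algebra.Properties.CommutativeSemigroup +-commutativeSemigroup using (x∙yz≈y∙xz)
import Data.List.Relation.Binary.Permutation.Setoid.Properties as Permutationₛ
import Data.List.Relation.Unary.All.Properties as Allₚ
import Data.List.Relation.Unary.Unique.Propositional.Properties as Uniqueₚ

-- Lists without repetition

-- The convolution ⋆ is the product of the series ∑ fₙ zⁿ/[n]_q!. If E(z) is the series of the
-- constant sequence 1, then ε - ω has the series (E(tz) - t E(z))/(1 - t), so both sides of the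
-- theorem have the series (1 - t) E(z)/(E(tz) - t E(z)). In an arbitrary commutative ring neither
-- [n]_q! nor 1 - t is invertible; therefore the argument stays with recurrences for ⋆, cancels
-- summands only, and works with 1 + ⋯ + tʲ⁻¹ in place of powers of t. The automaton has its form
-- for two reasons. Without double descents, every descent is preceded by its own ascent; that
-- ascent is forced to carry t, every other one contributes 1 + t, and these are the γ-weights.
-- Moreover, a return to the initial state is allowed at a letter of any size. So the part before
-- the return is an increasing run, the part after it is an arbitrary word, and the inversions
-- between the two are counted by a q-binomial coefficient.

unique∧set⇒↭ : ∀ {a} {X : Set a} {xs ys : List X} → Unique xs → Unique ys →
  (∀ {x} → x ∈ xs → x ∈ ys) → (∀ {x} → x ∈ ys → x ∈ xs) → xs ↭ ys
unique∧set⇒↭ u v to from = ∼bag⇒↭ (unique∧set⇒bag u v (mk⇔ to from))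

-- Injectivity is asked on the list only: the rotation of values and the insertion of fixed points
-- are not injective on arbitrary lists.
map-unique-on : ∀ {a b} {X : Set a} {Y : Set b} (f : X → Y) {xs : List X} →
  (∀ {x x′} → x ∈ xs → x′ ∈ xs → f x ≡ f x′ → x ≡ x′) → Unique xs → Unique (map f xs)
map-unique-on f inj [] = []
map-unique-on f inj (x∉ ∷ u) =
  Allₚ.map⁺ (All.tabulate λ y∈ fx≡fy → All.lookup x∉ y∈ (inj (here refl) (there y∈) fx≡fy)) ∷
  map-unique-on f (λ p q → inj (there p) (there q)) u

bijection⇒↭ : ∀ {a b} {X : Set a} {Y : Set b} (f : X → Y) {xs : List X} {ys : List Y} →
  Unique xs → Unique ys →
  (∀ {x} → x ∈ xs → f x ∈ ys) →
  (∀ {x x′} → x ∈ xs → x′ ∈ xs → f x ≡ f x′ → x ≡ x′) →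
  (∀ {y} → y ∈ ys → ∃ λ x → x ∈ xs × y ≡ f x) →
  map f xs ↭ ys
bijection⇒↭ f u v to inj onto = unique∧set⇒↭ (map-unique-on f inj u) v
  (λ y∈ → let x , x∈ , y≡ = ∈-map⁻ f y∈ in subst (_∈ _) (sym y≡) (to x∈))
  (λ y∈ → let x , x∈ , y≡ = onto y∈ in subst (_∈ _) (sym y≡) (∈-map⁺ f x∈))

concatMap-unique : ∀ {a b} {X : Set a} {Y : Set b} {f : X → List Y} {xs : List X} (key : Y → X) →
  Unique xs → (∀ x → Unique (f x)) → (∀ {x y} → y ∈ f x → key y ≡ x) → Unique (concatMap f xs)
concatMap-unique key [] uf k = []
concatMap-unique {f = f} key (x∉ ∷ u) uf k = Uniqueₚ.++⁺ (uf _) (concatMap-unique key u uf k)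
  λ (y∈ , y∈′) → let x′ , x′∈ , y∈f = find (∈-concatMap⁻ f y∈′) in
    All.lookup x∉ x′∈ (trans (sym (k y∈)) (k y∈f))

∈⇒↭∷ : ∀ {a} {X : Set a} {x : X} {ys} → x ∈ ys → ∃ λ zs → ys ↭ x ∷ zs
∈⇒↭∷ {ys = y ∷ ys} (here refl) = ys , ↭-refl
∈⇒↭∷ {ys = y ∷ ys} (there x∈) =
  let zs , p = ∈⇒↭∷ x∈ in y ∷ zs , ↭-trans (prep y p) (swap y _ ↭-refl)

unique⊆⇒↭++ : ∀ {a} {X : Set a} {xs ys : List X} → Unique xs → (∀ {x} → x ∈ xs → x ∈ ys) →
  ∃ λ zs → ys ↭ xs ++ zs
unique⊆⇒↭++ {ys = ys} [] sub = ys , ↭-refl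
unique⊆⇒↭++ {xs = x ∷ xs} {ys} (x∉ ∷ u) sub =
  let zs , p = ∈⇒↭∷ (sub (here refl))
      rest : ∀ {y} → y ∈ xs → y ∈ zs
      rest y∈ = strip (λ e → All.lookup x∉ y∈ (sym e)) (∈-resp-↭ p (sub (there y∈)))
      ws , r = unique⊆⇒↭++ u rest
  in ws , ↭-trans p (prep x r)
  where
  strip : ∀ {y zs} → y ≢ x → y ∈ x ∷ zs → y ∈ zs
  strip y≢x (here e) = contradiction e y≢x
  strip y≢x (there y∈) = y∈

-- The pigeonhole principle, which makes a word of `n` distinct letters from [n] a rearrangement of
-- [n].
unique⊆∧length⇒↭ : ∀ {a} {X : Set a} {xs ys : List X} → Unique xs → (∀ {x} → x ∈ xs → x ∈ ys) →
  length xs ≡ length ys → xs ↭ ys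
unique⊆∧length⇒↭ {xs = xs} {ys} u sub eq with unique⊆⇒↭++ u sub
... | [] , p = ↭-sym (↭-trans p (++-identityʳ xs))
... | z ∷ zs , p = contradiction
  (trans (sym (length-++ xs)) (trans (sym (↭-length p)) (sym eq))) (m+1+n≢m (length xs))

unique-↭ : ∀ {a} {X : Set a} {xs ys : List X} → xs ↭ ys → Unique xs → Unique ys
unique-↭ {X = X} p = Permutationₛ.Unique-resp-↭ (≡-setoid X) (↭⇒↭ₛ p)

++-cancelˡ-↭ : ∀ {a} {X : Set a} (xs : List X) {ys zs} → xs ++ ys ↭ xs ++ zs → ys ↭ zs
++-cancelˡ-↭ [] p = p
++-cancelˡ-↭ (x ∷ xs) p = ++-cancelˡ-↭ xs (drop-∷ p)

-- Permutations of [n] as rearrangements of n ⋯ 2 1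

-- In decreasing order the new letter is the head; for words read from right to left this list is
-- the identity permutation.
down : ℕ → List ℕ
down zero    = []
down (suc n) = suc n ∷ down n

length-down : ∀ n → length (down n) ≡ n
length-down zero    = refl
length-down (suc n) = cong suc (length-down n)

∈-down⁻ : ∀ {n a} → a ∈ down n → 1 ≤ a × a ≤ n
∈-down⁻ {suc n} (here refl) = s≤s z≤n , ≤-refl
∈-down⁻ {suc n} (there a∈) = let p , q = ∈-down⁻ a∈ in p , m≤n⇒m≤1+n q

∈-down⁺ : ∀ {n a} → 1 ≤ a → a ≤ n → a ∈ down n
∈-down⁺ {zero} 1≤a a≤0 = contradiction (≤-trans 1≤a a≤0) λ ()
∈-down⁺ {suc n} {a} 1≤a a≤n with a ≟ suc n
... | yes refl = here refl
... | no a≢ = there (∈-down⁺ 1≤a (≤-pred (≤∧≢⇒< a≤n a≢)))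

down-unique : ∀ n → Unique (down n)
down-unique zero    = []
down-unique (suc n) =
  All.tabulate (λ a∈ e → 1+n≰n (≤-trans (≤-reflexive e) (proj₂ (∈-down⁻ a∈)))) ∷ down-unique n

words-unique : ∀ n m → Unique (words n m)
words-unique n zero    = [] ∷ []
words-unique n (suc m) = concatMap-unique {f = λ a → map (a ∷_) (words n m)} head₀
  (Uniqueₚ.map⁺ suc-injective (Uniqueₚ.upTo⁺ n))
  (λ a → Uniqueₚ.map⁺ ∷-injectiveʳ (words-unique n m))
  (λ y∈ → let _ , _ , e = ∈-map⁻ _ y∈ in cong head₀ e)
  where
  head₀ : List ℕ → ℕ
  head₀ []      = 0
  head₀ (a ∷ _) = a

∈-letters⁻ : ∀ {n a} → a ∈ map suc (upTo n) → a ∈ down n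
∈-letters⁻ a∈ = let i , i∈ , e = ∈-map⁻ suc a∈ in
  ∈-down⁺ (≤-trans (s≤s z≤n) (≤-reflexive (sym e))) (≤-trans (≤-reflexive e) (∈-upTo⁻ i∈))

∈-letters⁺ : ∀ {n a} → a ∈ down n → a ∈ map suc (upTo n)
∈-letters⁺ {a = zero} a∈ = contradiction (proj₁ (∈-down⁻ a∈)) λ ()
∈-letters⁺ {a = suc a} a∈ = ∈-map⁺ suc (∈-upTo⁺ (proj₂ (∈-down⁻ a∈)))

∈-words⁻ : ∀ n m {w} → w ∈ words n m → length w ≡ m × All (_∈ down n) w
∈-words⁻ n zero (here refl) = refl , []
∈-words⁻ n (suc m) w∈ =
  let a , a∈ , w∈a = find (∈-concatMap⁻ (λ a → map (a ∷_) (words n m)) w∈)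
      v , v∈ , e   = ∈-map⁻ (a ∷_) w∈a
      l , al       = ∈-words⁻ n m v∈
  in trans (cong length e) (cong suc l) , subst (All _) (sym e) (∈-letters⁻ a∈ ∷ al)

∈-words⁺ : ∀ n {w} → All (_∈ down n) w → w ∈ words n (length w)
∈-words⁺ n [] = here refl
∈-words⁺ n {a ∷ w} (a∈ ∷ al) =
  ∈-concatMap⁺ (λ a → map (a ∷_) (words n (length w))) (lose (∈-letters⁺ a∈) (∈-map⁺ (a ∷_) (∈-words⁺ n al)))

notElem⁻ : ∀ a w → T (notElem a w) → All (a ≢_) w
notElem⁻ a [] _ = []
notElem⁻ a (b ∷ w) p with a ≡ᵇ b in eq
... | false = (λ e → subst T eq (≡⇒≡ᵇ a b e)) ∷ notElem⁻ a w p

notElem⁺ : ∀ a w → All (a ≢_) w → T (notElem a w)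
notElem⁺ a [] _ = tt
notElem⁺ a (b ∷ w) (a≢b ∷ al) with a ≡ᵇ b in eq
... | true  = a≢b (≡ᵇ⇒≡ a b (subst T (sym eq) tt))
... | false = notElem⁺ a w al

distinct⁻ : ∀ w → T (distinct w) → Unique w
distinct⁻ [] _ = []
distinct⁻ (a ∷ w) p = let p₁ , p₂ = Equivalence.to T-∧ p in notElem⁻ a w p₁ ∷ distinct⁻ w p₂

distinct⁺ : ∀ w → Unique w → T (distinct w)
distinct⁺ [] _ = tt
distinct⁺ (a ∷ w) (a∉ ∷ u) = Equivalence.from T-∧ (notElem⁺ a w a∉ , distinct⁺ w u)

perms-unique : ∀ n → Unique (perms n)
perms-unique n = Uniqueₚ.filter⁺ _ (words-unique n n)

∈-perms⁻ : ∀ n {σ} → σ ∈ perms n → σ ↭ down n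
∈-perms⁻ n {σ} σ∈ =
  let w∈ , d = ∈-filter⁻ (λ w → T? (distinct w)) σ∈
      l , al = ∈-words⁻ n n w∈
  in unique⊆∧length⇒↭ (distinct⁻ σ d) (All.lookup al) (trans l (sym (length-down n)))

∈-perms⁺ : ∀ n {σ} → σ ↭ down n → σ ∈ perms n
∈-perms⁺ n {σ} p = ∈-filter⁺ (λ w → T? (distinct w))
  (subst (λ m → σ ∈ words n m) (trans (↭-length p) (length-down n))
    (∈-words⁺ n (All.tabulate (∈-resp-↭ p))))
  (distinct⁺ σ (unique-↭ (↭-sym p) (down-unique n)))

-- Finite sums and the q-binomial convolution

antidiag : ℕ → List (ℕ × ℕ)
antidiag zero    = (0 , 0) ∷ []
antidiag (suc n) = (0 , suc n) ∷ map (λ (k , j) → suc k , j) (antidiag n)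

∈-antidiag⁻ : ∀ n {k j} → (k , j) ∈ antidiag n → k + j ≡ n
∈-antidiag⁻ zero    (here refl) = refl
∈-antidiag⁻ (suc n) (here refl) = refl
∈-antidiag⁻ (suc n) (there p) with ∈-map⁻ _ p
... | _ , p′ , refl = cong suc (∈-antidiag⁻ n p′)

∈-antidiag⁺ : ∀ k j → (k , j) ∈ antidiag (k + j)
∈-antidiag⁺ zero    zero    = here refl
∈-antidiag⁺ zero    (suc j) = here refl
∈-antidiag⁺ (suc k) j       = there (∈-map⁺ _ (∈-antidiag⁺ k j))

antidiag-unique : ∀ n → Unique (antidiag n)
antidiag-unique zero    = [] ∷ []
antidiag-unique (suc n) =
  All.tabulate (λ p e → case (trans (cong proj₁ e) (cong proj₁ (proj₂ (proj₂ (∈-map⁻ _ p))))) of λ ()) ∷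
  Uniqueₚ.map⁺ (λ e → cong₂ _,_ (suc-injective (cong proj₁ e)) (cong proj₂ e)) (antidiag-unique n)

module FiniteSums {c ℓ : Level} (R : CommutativeRing c ℓ) where
  open CommutativeRing R public
    using (Carrier; _≈_; 0#; 1#; zeroˡ; zeroʳ; distribˡ; distribʳ)
    renaming (_+_ to _⊕_; _*_ to _⊗_; refl to ≈-refl; sym to ≈-sym; trans to ≈-trans; reflexive to ≈-reflexive;
      setoid to ≈-setoid; +-assoc to ⊕-assoc; +-comm to ⊕-comm; *-assoc to ⊗-assoc; *-comm to ⊗-comm;
      +-cong to ⊕-cong; +-congˡ to ⊕-congˡ; +-congʳ to ⊕-congʳ; *-cong to ⊗-cong; *-congˡ to ⊗-congˡ;
      *-congʳ to ⊗-congʳ; +-identityˡ to ⊕-identityˡ; +-identityʳ to ⊕-identityʳ; *-identityˡ to ⊗-identityˡ;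
      *-identityʳ to ⊗-identityʳ)
  open import Relation.Binary.Reasoning.Setoid ≈-setoid public
  open import Algebra.Solver.Ring.NaturalCoefficients.Default (CommutativeRing.commutativeSemiring R) public
    using (solve; _:=_; _:+_; _:*_; con)

  private variable
    a b : Level
    X : Set a
    Y : Set b

  ∑ : List X → (X → Carrier) → Carrier
  ∑ xs f = sumR R (map f xs)

  interchange = solve 4 (λ w x y z → (w :+ x) :+ (y :+ z) := (w :+ y) :+ (x :+ z)) ≈-refl

  ∑-cong : ∀ (xs : List X) {f g} → (∀ {x} → x ∈ xs → f x ≈ g x) → ∑ xs f ≈ ∑ xs g
  ∑-cong []       eq = ≈-refl
  ∑-cong (x ∷ xs) eq = ⊕-cong (eq (here refl)) (∑-cong xs (eq ∘ there))

  ∑-map : ∀ (h : X → Y) xs f → ∑ (map h xs) f ≈ ∑ xs (f ∘ h)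
  ∑-map h xs f = ≈-reflexive (cong (sumR R) (sym (map-∘ xs)))

  ∑-++ : ∀ (xs ys : List X) f → ∑ (xs ++ ys) f ≈ ∑ xs f ⊕ ∑ ys f
  ∑-++ []       ys f = ≈-sym (⊕-identityˡ _)
  ∑-++ (x ∷ xs) ys f = ≈-trans (⊕-congˡ (∑-++ xs ys f)) (≈-sym (⊕-assoc _ _ _))

  ∑-0 : ∀ (xs : List X) → ∑ xs (λ _ → 0#) ≈ 0#
  ∑-0 []       = ≈-refl
  ∑-0 (x ∷ xs) = ≈-trans (⊕-identityˡ _) (∑-0 xs)

  ∑-⊕ : ∀ (xs : List X) f g → ∑ xs (λ x → f x ⊕ g x) ≈ ∑ xs f ⊕ ∑ xs g
  ∑-⊕ []       f g = ≈-sym (⊕-identityˡ _)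
  ∑-⊕ (x ∷ xs) f g = ≈-trans (⊕-congˡ (∑-⊕ xs f g)) (interchange _ _ _ _)

  ∑-⊗ˡ : ∀ (xs : List X) r f → r ⊗ ∑ xs f ≈ ∑ xs (λ x → r ⊗ f x)
  ∑-⊗ˡ []       r f = zeroʳ r
  ∑-⊗ˡ (x ∷ xs) r f = ≈-trans (distribˡ r _ _) (⊕-congˡ (∑-⊗ˡ xs r f))

  ∑-⊗ʳ : ∀ (xs : List X) r f → ∑ xs f ⊗ r ≈ ∑ xs (λ x → f x ⊗ r)
  ∑-⊗ʳ []       r f = zeroˡ r
  ∑-⊗ʳ (x ∷ xs) r f = ≈-trans (distribʳ r _ _) (⊕-congˡ (∑-⊗ʳ xs r f))

  ∑-swap : ∀ (xs : List X) (ys : List Y) (f : X → Y → Carrier) →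
    ∑ xs (λ x → ∑ ys (f x)) ≈ ∑ ys (λ y → ∑ xs (λ x → f x y))
  ∑-swap []       ys f = ≈-sym (∑-0 ys)
  ∑-swap (x ∷ xs) ys f = ≈-trans (⊕-congˡ (∑-swap xs ys f)) (≈-sym (∑-⊕ ys (f x) _))

  ∑-↭ : ∀ {xs ys : List X} f → xs ↭ ys → ∑ xs f ≈ ∑ ys f
  ∑-↭ f _↭_.refl        = ≈-refl
  ∑-↭ f (prep x p)      = ⊕-congˡ (∑-↭ f p)
  ∑-↭ f (swap x y p)    = ≈-trans (≈-sym (⊕-assoc _ _ _))
    (≈-trans (⊕-cong (⊕-comm _ _) (∑-↭ f p)) (⊕-assoc _ _ _))
  ∑-↭ f (_↭_.trans p r) = ≈-trans (∑-↭ f p) (∑-↭ f r)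

  ∑-filter : ∀ {p} {P : X → Set p} (P? : ∀ x → Dec (P x)) (xs : List X) f →
    ∑ (filter P? xs) f ≈ ∑ xs (λ x → if does (P? x) then f x else 0#)
  ∑-filter P? []       f = ≈-refl
  ∑-filter P? (x ∷ xs) f with does (P? x)
  ... | true  = ⊕-congˡ (∑-filter P? xs f)
  ... | false = ≈-trans (∑-filter P? xs f) (≈-sym (⊕-identityˡ _))

  ∑-concatMap : ∀ (h : X → List Y) xs f → ∑ (concatMap h xs) f ≈ ∑ xs (λ x → ∑ (h x) f)
  ∑-concatMap h []       f = ≈-refl
  ∑-concatMap h (x ∷ xs) f = ≈-trans (∑-++ (h x) _ f) (⊕-congˡ (∑-concatMap h xs f))

  ∑-cartesianProduct : ∀ (xs : List X) (ys : List Y) f →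
    ∑ (cartesianProduct xs ys) f ≈ ∑ xs (λ x → ∑ ys (λ y → f (x , y)))
  ∑-cartesianProduct []       ys f = ≈-refl
  ∑-cartesianProduct (x ∷ xs) ys f =
    ≈-trans (∑-++ (map (x ,_) ys) _ f) (⊕-cong (∑-map (x ,_) ys f) (∑-cartesianProduct xs ys f))

  ∑-bijection : ∀ (f : X → Y) {xs ys} (g : Y → Carrier) → Unique xs → Unique ys →
    (∀ {x} → x ∈ xs → f x ∈ ys) →
    (∀ {x x′} → x ∈ xs → x′ ∈ xs → f x ≡ f x′ → x ≡ x′) →
    (∀ {y} → y ∈ ys → ∃ λ x → x ∈ xs × y ≡ f x) →
    ∑ xs (g ∘ f) ≈ ∑ ys g
  ∑-bijection f {xs} g u v to inj onto =
    ≈-trans (≈-sym (∑-map f xs g)) (∑-↭ g (bijection⇒↭ f u v to inj onto))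

  ∑² : ℕ → (ℕ → ℕ → Carrier) → Carrier
  ∑² n f = ∑ (antidiag n) (λ (k , j) → f k j)

  ∑²-cong : ∀ n {f g} → (∀ k j → k + j ≡ n → f k j ≈ g k j) → ∑² n f ≈ ∑² n g
  ∑²-cong n eq = ∑-cong (antidiag n) (λ p → eq _ _ (∈-antidiag⁻ n p))

  ∑²-suc : ∀ n f → ∑² (suc n) f ≈ f 0 (suc n) ⊕ ∑² n (λ k j → f (suc k) j)
  ∑²-suc n f = ⊕-congˡ (∑-map _ (antidiag n) _)

  ∑²-sucʳ : ∀ n f → ∑² (suc n) f ≈ ∑² n (λ k j → f k (suc j)) ⊕ f (suc n) 0
  ∑²-sucʳ zero    f = ⊕-cong (≈-sym (⊕-identityʳ _)) (⊕-identityʳ _)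
  ∑²-sucʳ (suc n) f = begin
    ∑² (suc (suc n)) f
      ≈⟨ ∑²-suc (suc n) f ⟩
    f 0 (suc (suc n)) ⊕ ∑² (suc n) (λ k j → f (suc k) j)
      ≈⟨ ⊕-congˡ (∑²-sucʳ n _) ⟩
    f 0 (suc (suc n)) ⊕ (∑² n (λ k j → f (suc k) (suc j)) ⊕ f (suc (suc n)) 0)
      ≈⟨ ≈-sym (⊕-assoc _ _ _) ⟩
    (f 0 (suc (suc n)) ⊕ ∑² n (λ k j → f (suc k) (suc j))) ⊕ f (suc (suc n)) 0
      ≈⟨ ⊕-congʳ (≈-sym (∑²-suc n _)) ⟩
    ∑² (suc n) (λ k j → f k (suc j)) ⊕ f (suc (suc n)) 0 ∎

  ∑²-assoc : ∀ n (h : ℕ → ℕ → ℕ → Carrier) →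
    ∑² n (λ i m → ∑² m (h i)) ≈ ∑² n (λ m k → ∑² m (λ i j → h i j k))
  ∑²-assoc zero    h = ≈-refl
  ∑²-assoc (suc n) h = begin
    ∑² (suc n) (λ i m → ∑² m (h i))
      ≈⟨ ∑²-suc n _ ⟩
    ∑² (suc n) (h 0) ⊕ ∑² n (λ i m → ∑² m (h (suc i)))
      ≈⟨ ⊕-cong (∑²-suc n (h 0)) (∑²-assoc n (λ i → h (suc i))) ⟩
    (h 0 0 (suc n) ⊕ ∑² n (λ m k → h 0 (suc m) k)) ⊕ ∑² n (λ m k → ∑² m (λ i j → h (suc i) j k))
      ≈⟨ ⊕-assoc _ _ _ ⟩
    h 0 0 (suc n) ⊕ (∑² n (λ m k → h 0 (suc m) k) ⊕ ∑² n (λ m k → ∑² m (λ i j → h (suc i) j k)))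
      ≈⟨ ⊕-cong (≈-sym (⊕-identityʳ _)) (≈-sym (≈-trans
           (∑²-cong n (λ m k _ → ∑²-suc m (λ i j → h i j k)))
           (∑-⊕ (antidiag n) _ _))) ⟩
    ∑² 0 (λ i j → h i j (suc n)) ⊕ ∑² n (λ m k → ∑² (suc m) (λ i j → h i j k))
      ≈⟨ ≈-sym (∑²-suc n _) ⟩
    ∑² (suc n) (λ m k → ∑² m (λ i j → h i j k)) ∎

  pow-+ : ∀ x m n → pow R x (m + n) ≈ pow R x m ⊗ pow R x n
  pow-+ x zero    n = ≈-sym (⊗-identityˡ _)
  pow-+ x (suc m) n = ≈-trans (⊗-congˡ (pow-+ x m n)) (≈-sym (⊗-assoc _ _ _))

  pow-1 : ∀ n → pow R 1# n ≈ 1#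
  pow-1 zero    = ≈-refl
  pow-1 (suc n) = ≈-trans (⊗-identityˡ _) (pow-1 n)

  module QBinomial (q : Carrier) where
    infixr 8 q^_
    q^_ : ℕ → Carrier
    q^_ = pow R q

    -- B k j is the Gaussian binomial coefficient of k + j over k.
    B : ℕ → ℕ → Carrier
    B zero    j       = 1#
    B (suc k) zero    = 1#
    B (suc k) (suc j) = B k (suc j) ⊕ q^ suc k ⊗ B (suc k) j

    B-zeroʳ : ∀ k → B k 0 ≈ 1#
    B-zeroʳ zero    = ≈-refl
    B-zeroʳ (suc k) = ≈-refl

    -- The mirror image of the defining rule under the symmetry that exchanges `k` and `j`.
    B-pascal : ∀ k j → B (suc k) (suc j) ≈ q^ suc j ⊗ B k (suc j) ⊕ B (suc k) j
    B-pascal zero    zero    = ⊕-comm _ _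
    B-pascal zero    (suc j) = ≈-trans (⊕-congˡ (⊗-congˡ (B-pascal zero j))) (solution _ _ _)
      where
      solution = solve 3 (λ p r x → con 1 :+ r :* con 1 :* (p :* con 1 :+ x) :=
        r :* p :* con 1 :+ (con 1 :+ r :* con 1 :* x)) ≈-refl
    B-pascal (suc k) zero    = begin
      B (suc k) 1 ⊕ q^ suc (suc k) ⊗ 1#                        ≈⟨ ⊕-congʳ (B-pascal k zero) ⟩
      (q^ 1 ⊗ B k 1 ⊕ B (suc k) 0) ⊕ q^ suc (suc k) ⊗ 1#       ≈⟨ solution _ _ _ ⟩
      q^ 1 ⊗ (B k 1 ⊕ q^ suc k ⊗ 1#) ⊕ 1#                      ∎
      where
      solution = solve 3 (λ q b p → (q :* con 1 :* b :+ con 1) :+ q :* p :* con 1 :=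
        q :* con 1 :* (b :+ p :* con 1) :+ con 1) ≈-refl
    B-pascal (suc k) (suc j) = begin
      B (suc k) (suc (suc j)) ⊕ q^ suc (suc k) ⊗ B (suc (suc k)) (suc j)
        ≈⟨ ⊕-cong (B-pascal k (suc j)) (⊗-congˡ (B-pascal (suc k) j)) ⟩
      (q^ suc (suc j) ⊗ B k (suc (suc j)) ⊕ B (suc k) (suc j))
        ⊕ q^ suc (suc k) ⊗ (q^ suc j ⊗ B (suc k) (suc j) ⊕ B (suc (suc k)) j)
        ≈⟨ solution _ _ _ _ _ _ ⟩
      q^ suc (suc j) ⊗ (B k (suc (suc j)) ⊕ q^ suc k ⊗ B (suc k) (suc j))
        ⊕ (B (suc k) (suc j) ⊕ q^ suc (suc k) ⊗ B (suc (suc k)) j) ∎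
      where
      solution = solve 6 (λ q j k x y z → (q :* j :* x :+ y) :+ q :* k :* (j :* y :+ z) :=
        q :* j :* (x :+ k :* y) :+ (y :+ q :* k :* z)) ≈-refl

    -- Both products are the q-trinomial coefficient: expanding by the defining rule gives the same
    -- three-term recursion. This is what makes `_⋆_` associative.
    B-trinomial : ∀ i j k → B (i + j) k ⊗ B i j ≈ B i (j + k) ⊗ B j k
    B-trinomial zero    j       k       = ⊗-comm _ _
    B-trinomial (suc i) zero    k       = ≈-trans (⊗-congʳ (≈-reflexive (cong (λ m → B (suc m) k) (+-identityʳ i)))) ≈-refl
    B-trinomial (suc i) (suc j) zero    = ≈-trans (⊗-identityˡ _)
      (≈-trans (≈-reflexive (cong (λ m → B (suc i) (suc m)) (sym (+-identityʳ j)))) (≈-sym (⊗-identityʳ _)))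
    B-trinomial (suc i) (suc j) (suc k) = begin
      (B (i + suc j) (suc k) ⊕ q^ suc (i + suc j) ⊗ B (suc i + suc j) k) ⊗ B (suc i) (suc j)
        ≈⟨ split₁ _ _ _ _ _ _ ⟩
      B (i + suc j) (suc k) ⊗ B i (suc j) ⊕ (q^ suc i ⊗ (B (i + suc j) (suc k) ⊗ B (suc i) j)
        ⊕ q^ (suc i + suc j) ⊗ (B (suc i + suc j) k ⊗ B (suc i) (suc j)))
        ≈⟨ ⊕-cong (B-trinomial i (suc j) (suc k))
             (⊕-cong (⊗-congˡ (≈-trans (⊗-congʳ (≈-reflexive (cong (λ m → B m (suc k)) (+-suc i j))))
                                       (B-trinomial (suc i) j (suc k))))
                     (⊗-cong (pow-+ q (suc i) (suc j)) (B-trinomial (suc i) (suc j) k))) ⟩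
      B i (suc j + suc k) ⊗ B (suc j) (suc k) ⊕ (q^ suc i ⊗ (B (suc i) (j + suc k) ⊗ B j (suc k))
        ⊕ (q^ suc i ⊗ q^ suc j) ⊗ (B (suc i) (suc j + k) ⊗ B (suc j) k))
        ≈⟨ ⊕-congˡ (⊕-congˡ (⊗-congˡ (⊗-congʳ (≈-reflexive (cong (B (suc i)) (sym (+-suc j k))))))) ⟩
      B i (suc j + suc k) ⊗ B (suc j) (suc k) ⊕ (q^ suc i ⊗ (B (suc i) (j + suc k) ⊗ B j (suc k))
        ⊕ (q^ suc i ⊗ q^ suc j) ⊗ (B (suc i) (j + suc k) ⊗ B (suc j) k))
        ≈⟨ split₂ _ _ _ _ _ _ ⟩
      (B i (suc j + suc k) ⊕ q^ suc i ⊗ B (suc i) (j + suc k)) ⊗ (B j (suc k) ⊕ q^ suc j ⊗ B (suc j) k) ∎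
      where
      split₁ = solve 6 (λ x p y u r v → (x :+ p :* y) :* (u :+ r :* v) :=
        x :* u :+ (r :* (x :* v) :+ p :* (y :* (u :+ r :* v)))) ≈-refl
      split₂ = solve 6 (λ x r s y u v → x :* (u :+ s :* v) :+ (r :* (y :* u) :+ (r :* s) :* (y :* v)) :=
        (x :+ r :* y) :* (u :+ s :* v)) ≈-refl

    -- The defining rule applies to the interior terms only; the two end terms have coefficient 1
    -- and complete one sum each.
    ∑²-pascal : ∀ m (g : ℕ → ℕ → Carrier) → ∑² (suc m) (λ j r → B j r ⊗ g j r) ≈
      ∑² m (λ j r → q^ j ⊗ B j r ⊗ g j (suc r)) ⊕ ∑² m (λ j r → B j r ⊗ g (suc j) r)
    ∑²-pascal zero    g = solution _ _
      where
      solution = solve 2 (λ x y → con 1 :* x :+ (con 1 :* y :+ con 0) :=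
        (con 1 :* con 1 :* x :+ con 0) :+ (con 1 :* y :+ con 0)) ≈-refl
    ∑²-pascal (suc m) g = begin
      ∑² (suc (suc m)) (λ j r → B j r ⊗ g j r)
        ≈⟨ ≈-trans (∑²-suc (suc m) _) (⊕-congˡ (∑²-sucʳ m _)) ⟩
      1# ⊗ g 0 (suc (suc m)) ⊕ (∑² m (λ j r → B (suc j) (suc r) ⊗ g (suc j) (suc r)) ⊕ 1# ⊗ g (suc (suc m)) 0)
        ≈⟨ ⊕-congˡ (⊕-congʳ (≈-trans (∑²-cong m (λ j r _ → distribʳ _ _ _)) (∑-⊕ (antidiag m) _ _))) ⟩
      1# ⊗ g 0 (suc (suc m)) ⊕ ((∑² m (λ j r → B j (suc r) ⊗ g (suc j) (suc r))
        ⊕ ∑² m (λ j r → q^ suc j ⊗ B (suc j) r ⊗ g (suc j) (suc r))) ⊕ 1# ⊗ g (suc (suc m)) 0)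
        ≈⟨ solution _ _ _ _ ⟩
      (1# ⊗ 1# ⊗ g 0 (suc (suc m)) ⊕ ∑² m (λ j r → q^ suc j ⊗ B (suc j) r ⊗ g (suc j) (suc r)))
        ⊕ (∑² m (λ j r → B j (suc r) ⊗ g (suc j) (suc r)) ⊕ 1# ⊗ g (suc (suc m)) 0)
        ≈⟨ ⊕-cong (≈-sym (∑²-suc m (λ j r → q^ j ⊗ B j r ⊗ g j (suc r))))
                  (≈-sym (≈-trans (∑²-sucʳ m (λ j r → B j r ⊗ g (suc j) r)) (⊕-congˡ (⊗-congʳ (B-zeroʳ (suc m)))))) ⟩
      ∑² (suc m) (λ j r → q^ j ⊗ B j r ⊗ g j (suc r)) ⊕ ∑² (suc m) (λ j r → B j r ⊗ g (suc j) r) ∎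
      where
      solution = solve 4 (λ a x y z → con 1 :* a :+ ((x :+ y) :+ con 1 :* z) :=
        (con 1 :* con 1 :* a :+ y) :+ (x :+ con 1 :* z)) ≈-refl

    infixl 7 _⋆_
    _⋆_ : (ℕ → Carrier) → (ℕ → Carrier) → ℕ → Carrier
    (f ⋆ g) n = ∑² n (λ k j → B k j ⊗ (f k ⊗ g j))

    ⋆-assoc : ∀ f g h n → (f ⋆ (g ⋆ h)) n ≈ ((f ⋆ g) ⋆ h) n
    ⋆-assoc f g h n = begin
      ∑² n (λ i m → B i m ⊗ (f i ⊗ ∑² m (λ j k → B j k ⊗ (g j ⊗ h k))))
        ≈⟨ ∑²-cong n (λ i m _ → ≈-trans (⊗-congˡ (∑-⊗ˡ (antidiag m) _ _)) (∑-⊗ˡ (antidiag m) _ _)) ⟩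
      ∑² n (λ i m → ∑² m (λ j k → B i m ⊗ (f i ⊗ (B j k ⊗ (g j ⊗ h k)))))
        ≈⟨ ∑²-cong n (λ i m _ → ∑²-cong m (λ j k e →
             ≈-trans (solution₁ _ _ _ _ _)
               (⊗-congʳ (⊗-congʳ (≈-reflexive (cong (B i) (sym e))))))) ⟩
      ∑² n (λ i m → ∑² m (λ j k → B i (j + k) ⊗ B j k ⊗ (f i ⊗ g j ⊗ h k)))
        ≈⟨ ∑²-assoc n (λ i j k → B i (j + k) ⊗ B j k ⊗ (f i ⊗ g j ⊗ h k)) ⟩
      ∑² n (λ m k → ∑² m (λ i j → B i (j + k) ⊗ B j k ⊗ (f i ⊗ g j ⊗ h k)))
        ≈⟨ ∑²-cong n (λ m k _ → ∑²-cong m (λ i j e →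
             ≈-trans (⊗-congʳ (≈-trans (≈-sym (B-trinomial i j k)) (⊗-congʳ (≈-reflexive (cong (λ l → B l k) e)))))
               (solution₂ _ _ _ _ _))) ⟩
      ∑² n (λ m k → ∑² m (λ i j → B m k ⊗ (B i j ⊗ (f i ⊗ g j) ⊗ h k)))
        ≈⟨ ∑²-cong n (λ m k _ → ≈-sym (≈-trans (⊗-congˡ (∑-⊗ʳ (antidiag m) _ _)) (∑-⊗ˡ (antidiag m) _ _))) ⟩
      ∑² n (λ m k → B m k ⊗ (∑² m (λ i j → B i j ⊗ (f i ⊗ g j)) ⊗ h k)) ∎
      where
      solution₁ = solve 5 (λ a x b y z → a :* (x :* (b :* (y :* z))) := a :* b :* (x :* y :* z)) ≈-refl
      solution₂ = solve 5 (λ a b x y z → a :* b :* (x :* y :* z) := a :* (b :* (x :* y) :* z)) ≈-refl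

    ⋆-cong : ∀ {f f′ g g′} → (∀ k → f k ≈ f′ k) → (∀ j → g j ≈ g′ j) → ∀ n → (f ⋆ g) n ≈ (f′ ⋆ g′) n
    ⋆-cong eq eq′ n = ∑²-cong n (λ k j _ → ⊗-congˡ (⊗-cong (eq k) (eq′ j)))

    ⋆-distribʳ : ∀ f f′ g n → ((λ k → f k ⊕ f′ k) ⋆ g) n ≈ (f ⋆ g) n ⊕ (f′ ⋆ g) n
    ⋆-distribʳ f f′ g n = ≈-trans
      (∑²-cong n (λ k j _ → ≈-trans (⊗-congˡ (distribʳ _ _ _)) (distribˡ _ _ _))) (∑-⊕ (antidiag n) _ _)

    ⋆-distribˡ : ∀ f g g′ n → (f ⋆ (λ j → g j ⊕ g′ j)) n ≈ (f ⋆ g) n ⊕ (f ⋆ g′) n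
    ⋆-distribˡ f g g′ n = ≈-trans
      (∑²-cong n (λ k j _ → ≈-trans (⊗-congˡ (distribˡ _ _ _)) (distribˡ _ _ _))) (∑-⊕ (antidiag n) _ _)

    ε : ℕ → Carrier
    ε zero    = 1#
    ε (suc _) = 0#

    ⋆-identityˡ : ∀ f n → (ε ⋆ f) n ≈ f n
    ⋆-identityˡ f zero    = solve 1 (λ x → con 1 :* (con 1 :* x) :+ con 0 := x) ≈-refl _
    ⋆-identityˡ f (suc n) = ≈-trans (∑²-suc n _) (≈-trans
      (⊕-cong (≈-trans (⊗-identityˡ _) (⊗-identityˡ _))
        (≈-trans (∑²-cong n (λ k j _ → ≈-trans (⊗-congˡ (zeroˡ _)) (zeroʳ _))) (∑-0 (antidiag n))))
      (⊕-identityʳ _))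

    ⋆-identityʳ : ∀ f n → (f ⋆ ε) n ≈ f n
    ⋆-identityʳ f zero    = solve 1 (λ x → con 1 :* (x :* con 1) :+ con 0 := x) ≈-refl _
    ⋆-identityʳ f (suc n) = ≈-trans (∑²-sucʳ n _) (≈-trans
      (⊕-cong (≈-trans (∑²-cong n (λ k j _ → ≈-trans (⊗-congˡ (zeroʳ _)) (zeroʳ _))) (∑-0 (antidiag n)))
        (≈-trans (⊗-identityˡ _) (⊗-identityʳ _)))
      (⊕-identityˡ _))

-- Removing the first letter of a permutation

<ᵇ-true : ∀ {a b} → a < b → (a <ᵇ b) ≡ true
<ᵇ-true a<b = Equivalence.to T-≡ (<⇒<ᵇ a<b)

<ᵇ-false : ∀ {a b} → b ≤ a → (a <ᵇ b) ≡ false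
<ᵇ-false {a} {b} b≤a with a <ᵇ b in eq
... | false = refl
... | true  = contradiction (<ᵇ⇒< a b (subst T (sym eq) tt)) (≤⇒≯ b≤a)

StrictlyMonotone : (ℕ → ℕ) → Set
StrictlyMonotone f = ∀ {x y} → x < y → f x < f y

monotone-<ᵇ : ∀ {f} → StrictlyMonotone f → ∀ x y → (f x <ᵇ f y) ≡ (x <ᵇ y)
monotone-<ᵇ {f} mono x y with <-cmp x y
... | tri< x<y _ _  = trans (<ᵇ-true (mono x<y)) (sym (<ᵇ-true x<y))
... | tri≈ _ refl _ = trans (<ᵇ-false {f x} ≤-refl) (sym (<ᵇ-false {x} ≤-refl))
... | tri> _ _ y<x  = trans (<ᵇ-false (<⇒≤ (mono y<x))) (sym (<ᵇ-false (<⇒≤ y<x)))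

monotone-injective : ∀ {f} → StrictlyMonotone f → ∀ {x y} → f x ≡ f y → x ≡ y
monotone-injective mono {x} {y} e with <-cmp x y
... | tri< x<y _ _ = contradiction e (<⇒≢ (mono x<y))
... | tri≈ _ x≡y _ = x≡y
... | tri> _ _ y<x = contradiction (sym e) (<⇒≢ (mono y<x))

punch : ℕ → ℕ → ℕ
punch i x = if x <ᵇ suc i then x else suc x

punch-≤ : ∀ {i x} → x ≤ i → punch i x ≡ x
punch-≤ x≤i rewrite <ᵇ-true (s≤s x≤i) = refl

punch-> : ∀ {i x} → i < x → punch i x ≡ suc x
punch-> i<x rewrite <ᵇ-false i<x = refl

punch-monotone : ∀ i → StrictlyMonotone (punch i)
punch-monotone i {x} {y} x<y with x ≤? i | y ≤? i
... | yes p | yes r rewrite punch-≤ p | punch-≤ r = x<y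
... | yes p | no r  rewrite punch-≤ p | punch-> (≰⇒> r) = m<n⇒m<1+n x<y
... | no p  | yes r = contradiction (≤-trans (<⇒≤ x<y) r) p
... | no p  | no r  rewrite punch-> (≰⇒> p) | punch-> (≰⇒> r) = s≤s x<y

punch-<ᵇ : ∀ i x → (punch i x <ᵇ suc i) ≡ (x <ᵇ suc i)
punch-<ᵇ i x with x ≤? i
... | yes p rewrite punch-≤ p = refl
... | no p  rewrite punch-> (≰⇒> p) = trans (<ᵇ-false (<⇒≤ (≰⇒> p))) (sym (<ᵇ-false (≰⇒> p)))

map-punch-down : ∀ {i n} → n ≤ i → map (punch i) (down n) ≡ down n
map-punch-down {n = zero}  _   = refl
map-punch-down {n = suc n} n<i = cong₂ _∷_ (punch-≤ n<i) (map-punch-down (<⇒≤ n<i))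

punch-down : ∀ {i} n → i ≤ n → suc i ∷ map (punch i) (down n) ↭ down (suc n)
punch-down {i} n i≤n with i ≟ n
... | yes refl = ↭-reflexive (cong (suc n ∷_) (map-punch-down ≤-refl))
punch-down zero    z≤n | no i≢n = contradiction refl i≢n
punch-down {i} (suc n) i≤n | no i≢n =
  ↭-trans (↭-reflexive (cong (λ x → suc i ∷ x ∷ map (punch i) (down n)) (punch-> (≤∧≢⇒< i≤n i≢n))))
  (↭-trans (swap _ _ ↭-refl) (prep _ (punch-down n (≤-pred (≤∧≢⇒< i≤n i≢n)))))

-- The index is one less than the first letter: it is the number of smaller letters, all of which
-- come later, hence the number of new inversions.
prepend : ℕ × List ℕ → List ℕ
prepend (i , σ) = suc i ∷ map (punch i) σ

prepend-perm : ∀ n {i σ} → i ≤ n → σ ↭ down n → prepend (i , σ) ↭ down (suc n)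
prepend-perm n i≤n p = ↭-trans (prep _ (map⁺ _ p)) (punch-down n i≤n)

prepend-injective : ∀ {x y} → prepend x ≡ prepend y → x ≡ y
prepend-injective {i , σ} {j , τ} e with suc-injective (∷-injectiveˡ e)
... | refl = cong (i ,_) (map-injective (monotone-injective (punch-monotone i)) (∷-injectiveʳ e))

prepend-onto : ∀ n {σ} → σ ↭ down (suc n) → ∃₂ λ i τ → i ≤ n × τ ↭ down n × σ ≡ prepend (i , τ)
prepend-onto n {[]} p = contradiction (↭-sym p) ¬x∷xs↭[]
prepend-onto n {zero ∷ σ} p = contradiction (proj₁ (∈-down⁻ (∈-resp-↭ p (here refl)))) λ ()
prepend-onto n {suc i ∷ σ} p =
  let i≤n = ≤-pred (proj₂ (∈-down⁻ (∈-resp-↭ p (here refl))))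
      τ , σ≡ , r = ↭-map-inv (punch i) (drop-∷ (↭-trans (punch-down n i≤n) (↭-sym p)))
  in i , τ , i≤n , ↭-sym r , cong (suc i ∷_) σ≡

countLess-monotone : ∀ {f} → StrictlyMonotone f → ∀ a l → countLess (f a) (map f l) ≡ countLess a l
countLess-monotone mono a []      = refl
countLess-monotone mono a (b ∷ l) = cong₂ _+_ (cong b2n (monotone-<ᵇ mono b a)) (countLess-monotone mono a l)

inv-monotone : ∀ {f} → StrictlyMonotone f → ∀ l → inv (map f l) ≡ inv l
inv-monotone mono []      = refl
inv-monotone mono (a ∷ l) = cong₂ _+_ (countLess-monotone mono a l) (inv-monotone mono l)

countLess-punch : ∀ i l → countLess (suc i) (map (punch i) l) ≡ countLess (suc i) l
countLess-punch i []      = refl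
countLess-punch i (x ∷ l) = cong₂ _+_ (cong b2n (punch-<ᵇ i x)) (countLess-punch i l)

countLess-↭ : ∀ a {l l′} → l ↭ l′ → countLess a l ≡ countLess a l′
countLess-↭ a _↭_.refl        = refl
countLess-↭ a (prep x p)      = cong (_ +_) (countLess-↭ a p)
countLess-↭ a {_ ∷ _ ∷ l} (swap x y p) = trans
  (x∙yz≈y∙xz (b2n (x <ᵇ a)) (b2n (y <ᵇ a)) (countLess a l))
  (cong (λ m → b2n (y <ᵇ a) + (b2n (x <ᵇ a) + m)) (countLess-↭ a p))
countLess-↭ a (_↭_.trans p r) = trans (countLess-↭ a p) (countLess-↭ a r)

countLess-down-≥ : ∀ {i} n → n ≤ i → countLess (suc i) (down n) ≡ n
countLess-down-≥ zero    _   = refl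
countLess-down-≥ (suc n) n<i rewrite <ᵇ-true (s≤s n<i) = cong suc (countLess-down-≥ n (<⇒≤ n<i))

countLess-down : ∀ {i} n → i ≤ n → countLess (suc i) (down n) ≡ i
countLess-down zero z≤n = refl
countLess-down {i} (suc n) i≤n with i ≟ suc n
... | yes refl = countLess-down-≥ (suc n) ≤-refl
... | no i≢n rewrite <ᵇ-false (≤∧≢⇒< i≤n i≢n) = countLess-down n (≤-pred (≤∧≢⇒< i≤n i≢n))

inv-prepend : ∀ n {i σ} → i ≤ n → σ ↭ down n → inv (prepend (i , σ)) ≡ i + inv σ
inv-prepend n {i} {σ} i≤n p = cong₂ _+_
  (trans (countLess-punch i σ) (trans (countLess-↭ (suc i) p) (countLess-down n i≤n)))
  (inv-monotone (punch-monotone i) σ)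

range : ℕ → ℕ → List ℕ
range c zero    = []
range c (suc m) = c ∷ range (suc c) m

∈-range⁻ : ∀ {c m i} → i ∈ range c m → c ≤ i × i < c + m
∈-range⁻ {c} {suc m} (here refl) = ≤-refl , subst (c <_) (sym (+-suc c m)) (s≤s (m≤m+n c m))
∈-range⁻ {c} {suc m} {i} (there i∈) = let p , r = ∈-range⁻ i∈ in <⇒≤ p , subst (i <_) (sym (+-suc c m)) r

∈-range⁺ : ∀ {c m i} → c ≤ i → i < c + m → i ∈ range c m
∈-range⁺ {c} {zero}  c≤i i<c = contradiction c≤i (<⇒≱ (subst (_ <_) (+-identityʳ c) i<c))
∈-range⁺ {c} {suc m} {i} c≤i i< with c ≟ i
... | yes refl = here refl
... | no c≢i   = there (∈-range⁺ (≤∧≢⇒< c≤i c≢i) (subst (i <_) (+-suc c m) i<))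

range-unique : ∀ c m → Unique (range c m)
range-unique c zero    = []
range-unique c (suc m) = All.tabulate (λ i∈ e → 1+n≰n (subst (suc c ≤_) (sym e) (proj₁ (∈-range⁻ i∈)))) ∷ range-unique (suc c) m

range-++ : ∀ c m n → range c (m + n) ≡ range c m ++ range (c + m) n
range-++ c zero    n = cong (λ d → range d n) (sym (+-identityʳ c))
range-++ c (suc m) n = cong (c ∷_) (trans (range-++ (suc c) m n) (cong (λ d → range (suc c) m ++ range d n) (sym (+-suc c m))))

-- The automaton and its recursion on the first letter

module GammaSide {c ℓ : Level} (R : CommutativeRing c ℓ) (t q : CommutativeRing.Carrier R) where
  open FiniteSums R
  open QBinomial q

  t^_ : ℕ → Carrier
  t^_ = pow R t

  ∑-perms-suc : ∀ n f → ∑ (perms (suc n)) f ≈ ∑ (range 0 (suc n)) (λ i → ∑ (perms n) (λ σ → f (prepend (i , σ))))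
  ∑-perms-suc n f = ≈-trans
    (≈-sym (∑-bijection prepend f
      (Uniqueₚ.cartesianProduct⁺ (range-unique 0 (suc n)) (perms-unique n)) (perms-unique (suc n))
      (λ x∈ → let i∈ , σ∈ = ∈-cartesianProduct⁻ (range 0 (suc n)) (perms n) x∈ in
        ∈-perms⁺ (suc n) (prepend-perm n (≤-pred (proj₂ (∈-range⁻ i∈))) (∈-perms⁻ n σ∈)))
      (λ _ _ → prepend-injective)
      (λ y∈ → let i , τ , i≤n , p , e = prepend-onto n (∈-perms⁻ (suc n) y∈) in
        (i , τ) , ∈-cartesianProduct⁺ (∈-range⁺ z≤n (s≤s i≤n)) (∈-perms⁺ n p) , e)))
    (∑-cartesianProduct (range 0 (suc n)) (perms n) (f ∘ prepend))

  -- Read a word from left to right; after each ascent choose weight 1 or weight t, and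
  -- allow a descent only right after a chosen t (never at the start).  F and H sum the weights
  -- of all choices for the letters following a, where H means that t was just chosen.
  F H : ℕ → List ℕ → Carrier
  F a []      = 1#
  F a (x ∷ l) = if x <ᵇ a then 0# else F x l ⊕ t ⊗ H x l
  H a []      = 1#
  H a (x ∷ l) = if x <ᵇ a then F x l else F x l ⊕ t ⊗ H x l

  W : List ℕ → Carrier
  W []      = 1#
  W (a ∷ l) = F a l

  F-monotone : ∀ {f} → StrictlyMonotone f → ∀ a l → F (f a) (map f l) ≡ F a l
  H-monotone : ∀ {f} → StrictlyMonotone f → ∀ a l → H (f a) (map f l) ≡ H a l
  F-monotone mono a []      = refl
  F-monotone mono a (x ∷ l) rewrite monotone-<ᵇ mono x a | F-monotone mono x l | H-monotone mono x l = refl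
  H-monotone mono a []      = refl
  H-monotone mono a (x ∷ l) rewrite monotone-<ᵇ mono x a | F-monotone mono x l | H-monotone mono x l = refl

  -- Not an instance of `F-monotone`, since `punch i` moves `suc i`; but it carries no letter across
  -- the threshold `suc i`, and only the first comparison involves that threshold.
  F-punch : ∀ i l → F (suc i) (map (punch i) l) ≡ F (suc i) l
  F-punch i []      = refl
  F-punch i (x ∷ l) rewrite punch-<ᵇ i x | F-monotone (punch-monotone i) x l | H-monotone (punch-monotone i) x l = refl

  H-punch : ∀ i l → H (suc i) (map (punch i) l) ≡ H (suc i) l
  H-punch i []      = refl
  H-punch i (x ∷ l) rewrite punch-<ᵇ i x | F-monotone (punch-monotone i) x l | H-monotone (punch-monotone i) x l = refl

  G : ℕ → Carrier
  G n = ∑ (perms n) (λ σ → q^ inv σ ⊗ W σ)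

  -- For `c` at most `n`, the letter `suc c` stands for a predecessor that exceeds exactly `c`
  -- letters of the permutation.
  u v : ℕ → ℕ → Carrier
  v n c = ∑ (perms n) (λ σ → q^ inv σ ⊗ F (suc c) σ)
  u n c = ∑ (perms n) (λ σ → q^ inv σ ⊗ H (suc c) σ)

  ∑-weighted-perms-suc : ∀ n (f : List ℕ → Carrier) → ∑ (perms (suc n)) (λ σ → q^ inv σ ⊗ f σ) ≈
    ∑ (range 0 (suc n)) (λ i → q^ i ⊗ ∑ (perms n) (λ σ → q^ inv σ ⊗ f (prepend (i , σ))))
  ∑-weighted-perms-suc n f = ≈-trans (∑-perms-suc n _)
    (∑-cong (range 0 (suc n)) λ {i} i∈ → ≈-trans
      (∑-cong (perms n) λ {σ} σ∈ → ≈-trans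
        (⊗-congʳ (≈-trans (≈-reflexive (cong q^_ (inv-prepend n (≤-pred (proj₂ (∈-range⁻ i∈))) (∈-perms⁻ n σ∈))))
                          (pow-+ q i (inv σ))))
        (⊗-assoc _ _ _))
      (≈-sym (∑-⊗ˡ (perms n) _ _)))

  ∑-F⊕tH : ∀ n c → ∑ (perms n) (λ σ → q^ inv σ ⊗ (F (suc c) σ ⊕ t ⊗ H (suc c) σ)) ≈ v n c ⊕ t ⊗ u n c
  ∑-F⊕tH n c = ≈-trans (∑-cong (perms n) (λ _ → solution _ _ _ _))
    (≈-trans (∑-⊕ (perms n) _ _) (⊕-congˡ (≈-sym (∑-⊗ˡ (perms n) _ _))))
    where
    solution = solve 4 (λ p x t y → p :* (x :+ t :* y) := p :* x :+ t :* (p :* y)) ≈-refl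

  G-suc : ∀ n → G (suc n) ≈ ∑ (range 0 (suc n)) (λ i → q^ i ⊗ v n i)
  G-suc n = ≈-trans (∑-weighted-perms-suc n W)
    (∑-cong (range 0 (suc n)) λ {i} _ → ⊗-congˡ (∑-cong (perms n) λ {σ} _ → ⊗-congˡ (≈-reflexive (F-punch i σ))))

  ∑-range-if : ∀ c m (f g : ℕ → Carrier) → ∑ (range 0 (c + m)) (λ i → if i <ᵇ c then f i else g i) ≈
    ∑ (range 0 c) f ⊕ ∑ (range c m) g
  ∑-range-if c m f g = begin
    ∑ (range 0 (c + m)) h                 ≈⟨ ≈-reflexive (cong (λ r → ∑ r h) (range-++ 0 c m)) ⟩
    ∑ (range 0 c ++ range c m) h          ≈⟨ ∑-++ (range 0 c) _ h ⟩
    ∑ (range 0 c) h ⊕ ∑ (range c m) h     ≈⟨ ⊕-cong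
      (∑-cong (range 0 c) λ {i} i∈ → ≈-reflexive (cong (λ b → if b then f i else g i) (<ᵇ-true (proj₂ (∈-range⁻ i∈)))))
      (∑-cong (range c m) λ {i} i∈ → ≈-reflexive (cong (λ b → if b then f i else g i) (<ᵇ-false (proj₁ (∈-range⁻ i∈))))) ⟩
    ∑ (range 0 c) f ⊕ ∑ (range c m) g     ∎
    where
    h : ℕ → Carrier
    h i = if i <ᵇ c then f i else g i

  v-suc : ∀ n c m → suc n ≡ c + m → v (suc n) c ≈ ∑ (range c m) (λ i → q^ i ⊗ (v n i ⊕ t ⊗ u n i))
  v-suc n c m e = begin
    v (suc n) c
      ≈⟨ ∑-weighted-perms-suc n (F (suc c)) ⟩
    ∑ (range 0 (suc n)) (λ i → q^ i ⊗ ∑ (perms n) (λ σ → q^ inv σ ⊗ F (suc c) (prepend (i , σ))))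
      ≈⟨ ∑-cong (range 0 (suc n)) (λ {i} _ → step i) ⟩
    ∑ (range 0 (suc n)) (λ i → if i <ᵇ c then 0# else q^ i ⊗ (v n i ⊕ t ⊗ u n i))
      ≈⟨ ≈-reflexive (cong (λ k → ∑ (range 0 k) (λ i → if i <ᵇ c then 0# else q^ i ⊗ (v n i ⊕ t ⊗ u n i))) e) ⟩
    ∑ (range 0 (c + m)) (λ i → if i <ᵇ c then 0# else q^ i ⊗ (v n i ⊕ t ⊗ u n i))
      ≈⟨ ∑-range-if c m _ _ ⟩
    ∑ (range 0 c) (λ _ → 0#) ⊕ ∑ (range c m) (λ i → q^ i ⊗ (v n i ⊕ t ⊗ u n i))
      ≈⟨ ≈-trans (⊕-congʳ (∑-0 (range 0 c))) (⊕-identityˡ _) ⟩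
    ∑ (range c m) (λ i → q^ i ⊗ (v n i ⊕ t ⊗ u n i)) ∎
    where
    step : ∀ i → q^ i ⊗ ∑ (perms n) (λ σ → q^ inv σ ⊗ F (suc c) (prepend (i , σ))) ≈
      (if i <ᵇ c then 0# else q^ i ⊗ (v n i ⊕ t ⊗ u n i))
    step i with i <ᵇ c
    ... | true  = ≈-trans (⊗-congˡ (≈-trans (∑-cong (perms n) (λ _ → zeroʳ _)) (∑-0 (perms n)))) (zeroʳ _)
    ... | false = ⊗-congˡ (≈-trans
      (∑-cong (perms n) λ {σ} _ → ⊗-congˡ (≈-reflexive (cong₂ (λ x y → x ⊕ t ⊗ y) (F-punch i σ) (H-punch i σ))))
      (∑-F⊕tH n i))

  -- From `H` the return to `F` is open to every first letter, so these terms no longer depend on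
  -- `c` and add up to `G (suc n)`. Remaining in `H` requires an ascent, that is, a first letter
  -- `suc i` with `i` at least `c`.
  u-suc : ∀ n c m → suc n ≡ c + m → u (suc n) c ≈ G (suc n) ⊕ t ⊗ ∑ (range c m) (λ i → q^ i ⊗ u n i)
  u-suc n c m e = begin
    u (suc n) c
      ≈⟨ ∑-weighted-perms-suc n (H (suc c)) ⟩
    ∑ (range 0 (suc n)) (λ i → q^ i ⊗ ∑ (perms n) (λ σ → q^ inv σ ⊗ H (suc c) (prepend (i , σ))))
      ≈⟨ ∑-cong (range 0 (suc n)) (λ {i} _ → step i) ⟩
    ∑ (range 0 (suc n)) (λ i → q^ i ⊗ v n i ⊕ t ⊗ (if i <ᵇ c then 0# else q^ i ⊗ u n i))
      ≈⟨ ∑-⊕ (range 0 (suc n)) _ _ ⟩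
    ∑ (range 0 (suc n)) (λ i → q^ i ⊗ v n i) ⊕ ∑ (range 0 (suc n)) (λ i → t ⊗ (if i <ᵇ c then 0# else q^ i ⊗ u n i))
      ≈⟨ ⊕-cong (≈-sym (G-suc n)) (≈-sym (∑-⊗ˡ (range 0 (suc n)) t _)) ⟩
    G (suc n) ⊕ t ⊗ ∑ (range 0 (suc n)) (λ i → if i <ᵇ c then 0# else q^ i ⊗ u n i)
      ≈⟨ ⊕-congˡ (⊗-congˡ (≈-reflexive (cong (λ k → ∑ (range 0 k) (λ i → if i <ᵇ c then 0# else q^ i ⊗ u n i)) e))) ⟩
    G (suc n) ⊕ t ⊗ ∑ (range 0 (c + m)) (λ i → if i <ᵇ c then 0# else q^ i ⊗ u n i)
      ≈⟨ ⊕-congˡ (⊗-congˡ (≈-trans (∑-range-if c m _ _) (≈-trans (⊕-congʳ (∑-0 (range 0 c))) (⊕-identityˡ _)))) ⟩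
    G (suc n) ⊕ t ⊗ ∑ (range c m) (λ i → q^ i ⊗ u n i) ∎
    where
    solution₁ = solve 3 (λ p x t → p :* x := p :* x :+ t :* con 0) ≈-refl
    solution₂ = solve 4 (λ p x t y → p :* (x :+ t :* y) := p :* x :+ t :* (p :* y)) ≈-refl
    step : ∀ i → q^ i ⊗ ∑ (perms n) (λ σ → q^ inv σ ⊗ H (suc c) (prepend (i , σ))) ≈
      q^ i ⊗ v n i ⊕ t ⊗ (if i <ᵇ c then 0# else q^ i ⊗ u n i)
    step i with i <ᵇ c
    ... | true  = ≈-trans
      (⊗-congˡ (∑-cong (perms n) λ {σ} _ → ⊗-congˡ (≈-reflexive (F-punch i σ)))) (solution₁ _ _ _)
    ... | false = ≈-trans (⊗-congˡ (≈-trans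
      (∑-cong (perms n) λ {σ} _ → ⊗-congˡ (≈-reflexive (cong₂ (λ x y → x ⊕ t ⊗ y) (F-punch i σ) (H-punch i σ))))
      (∑-F⊕tH n i))) (solution₂ _ _ _ _)

-- Solving the recursion: the first return of the automaton

module GammaRecurrence {c ℓ : Level} (R : CommutativeRing c ℓ) (t q : CommutativeRing.Carrier R) where
  open FiniteSums R
  open QBinomial q
  open GammaSide R t q

  ⟨_⟩ : ℕ → Carrier
  ⟨ zero ⟩  = 0#
  ⟨ suc j ⟩ = ⟨ j ⟩ ⊕ t^ j

  shifted : (ℕ → Carrier) → ℕ → Carrier
  shifted w zero    = 0#
  shifted w (suc j) = w j

  t⟨⟩ : ℕ → Carrier
  t⟨⟩ j = t ⊗ ⟨ j ⟩

  ω : ℕ → Carrier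
  ω = shifted t⟨⟩

  -- An increasing run of `j` letters of weight `w j`, chosen among the `m` letters above `c`,
  -- followed by an arbitrary word in the other `c + r` letters. The inversions of the run with the
  -- `c` small letters give `q^ (c * j)`, those with the remaining `r` letters give `B j r`.
  K : (ℕ → Carrier) → ℕ → ℕ → Carrier
  K w c m = ∑² m (λ j r → B j r ⊗ (w j ⊗ q^ (c * j) ⊗ G (c + r)))

  K-cong : ∀ {w w′} → (∀ j → w j ≈ w′ j) → ∀ c m → K w c m ≈ K w′ c m
  K-cong eq c m = ∑²-cong m (λ j r _ → ⊗-congˡ (⊗-congʳ (⊗-congʳ (eq j))))

  K-linear : ∀ w s w′ c m → K (λ j → w j ⊕ s ⊗ w′ j) c m ≈ K w c m ⊕ s ⊗ K w′ c m
  K-linear w s w′ c m = ≈-trans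
    (∑²-cong m (λ j r _ → solution _ _ _ _ _ _))
    (≈-trans (∑-⊕ (antidiag m) _ _) (⊕-congˡ (≈-sym (∑-⊗ˡ (antidiag m) s _))))
    where
    solution = solve 6 (λ b x s y p g → b :* ((x :+ s :* y) :* p :* g) :=
      b :* (x :* p :* g) :+ s :* (b :* (y :* p :* g))) ≈-refl

  -- The letter `suc c` either stays outside the run and becomes one more small letter, or it is the
  -- first letter of the run and is inverted with the `c` letters below it.
  K-suc : ∀ w c m → K w c (suc m) ≈ K w (suc c) m ⊕ q^ c ⊗ K (w ∘ suc) c m
  K-suc w c m = ≈-trans (∑²-pascal m _) (⊕-cong
    (∑²-cong m (λ j r _ → ≈-trans (solution₁ _ _ _ _ _)
      (⊗-congˡ (⊗-cong (⊗-congˡ (≈-sym (pow-+ q j (c * j)))) (≈-reflexive (cong G (+-suc c r)))))))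
    (≈-trans (∑²-cong m (λ j r _ → ≈-trans
        (⊗-congˡ (⊗-congʳ (⊗-congˡ (≈-trans (≈-reflexive (cong q^_ (*-suc c j))) (pow-+ q c (c * j))))))
        (solution₂ _ _ _ _ _)))
      (≈-sym (∑-⊗ˡ (antidiag m) _ _))))
    where
    solution₁ = solve 5 (λ p b x r g → p :* b :* (x :* r :* g) := b :* (x :* (p :* r) :* g)) ≈-refl
    solution₂ = solve 5 (λ b x p r g → b :* (x :* (p :* r) :* g) := p :* (b :* (x :* r :* g))) ≈-refl

  -- The sum of `q^ i ⊗ φ i (c + m - 1 - i)` over `c ≤ i < c + m`: here `suc i` is the next letter,
  -- and the second argument counts the remaining letters above it.
  S : (ℕ → ℕ → Carrier) → ℕ → ℕ → Carrier
  S φ c zero    = 0#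
  S φ c (suc m) = S φ (suc c) m ⊕ q^ c ⊗ φ c m

  S-cong : ∀ {φ ψ} c m → (∀ c′ m′ → m′ < m → φ c′ m′ ≈ ψ c′ m′) → S φ c m ≈ S ψ c m
  S-cong c zero    eq = ≈-refl
  S-cong c (suc m) eq =
    ⊕-cong (S-cong (suc c) m (λ c′ m′ p → eq c′ m′ (m<n⇒m<1+n p))) (⊗-congˡ (eq c m ≤-refl))

  S-⊕ : ∀ φ ψ c m → S (λ c m → φ c m ⊕ ψ c m) c m ≈ S φ c m ⊕ S ψ c m
  S-⊕ φ ψ c zero    = ≈-sym (⊕-identityˡ _)
  S-⊕ φ ψ c (suc m) = ≈-trans (⊕-congʳ (S-⊕ φ ψ (suc c) m)) (solution _ _ _ _ _)
    where
    solution = solve 5 (λ a b p x y → (a :+ b) :+ p :* (x :+ y) := (a :+ p :* x) :+ (b :+ p :* y)) ≈-refl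

  S-K : ∀ w c m → S (K w) c m ≈ K (shifted w) c m
  S-K w c zero    = ≈-sym (solution _ _ _)
    where
    solution = solve 3 (λ b p g → b :* (con 0 :* p :* g) :+ con 0 := con 0) ≈-refl
  S-K w c (suc m) = ≈-trans (⊕-congʳ (S-K w (suc c) m)) (≈-sym (K-suc (shifted w) c m))

  ∑-range-S : ∀ (ψ : ℕ → ℕ → Carrier) n c m → suc n ≡ c + m →
    ∑ (range c m) (λ i → q^ i ⊗ ψ n i) ≈ S (λ c m → ψ (c + m) c) c m
  ∑-range-S ψ n c zero    e = ≈-refl
  ∑-range-S ψ n c (suc m) e = ≈-trans (⊕-comm _ _) (⊕-cong
    (∑-range-S ψ n (suc c) m (cong suc n≡c+m)) (⊗-congˡ (≈-reflexive (cong (λ k → ψ k c) n≡c+m))))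
    where
    n≡c+m : n ≡ c + m
    n≡c+m = suc-injective (trans e (+-suc c m))

  -- In the variables c and m = n - c the recursions for u n c and v n c are structural in m.
  U V : ℕ → ℕ → Carrier
  U c m = u (c + m) c
  V c m = v (c + m) c

  U-step : ∀ c m → U c m ≈ G (c + m) ⊕ t ⊗ S U c m
  U-step zero    zero    = solution _
    where
    solution = solve 1 (λ t → con 1 :* con 1 :+ con 0 := (con 1 :* con 1 :+ con 0) :+ t :* con 0) ≈-refl
  U-step zero    (suc m) = ≈-trans (u-suc m 0 (suc m) refl) (⊕-congˡ (⊗-congˡ (∑-range-S u m 0 (suc m) refl)))
  U-step (suc c) m       = ≈-trans (u-suc (c + m) (suc c) m refl)
    (⊕-congˡ (⊗-congˡ (∑-range-S u (c + m) (suc c) m refl)))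

  -- The empty run gives the summand `G (c + m)`, and every other run has a factor `t` to split off:
  -- by `S-K` this is the recursion of `U-step`.
  K-t^ : ∀ c m → K t^_ c m ≈ G (c + m) ⊕ t ⊗ K (shifted t^_) c m
  K-t^ c zero    = ≈-trans (⊕-congʳ (⊗-congˡ (⊗-congʳ (⊗-congˡ (≈-reflexive (cong q^_ (*-zeroʳ c)))))))
    (≈-trans (solution _ _) (⊕-congˡ (⊗-congˡ (S-K t^_ c 0))))
    where
    solution = solve 2 (λ t g → con 1 :* (con 1 :* con 1 :* g) :+ con 0 := g :+ t :* con 0) ≈-refl
  K-t^ c (suc m) = begin
    K t^_ c (suc m)
      ≈⟨ K-suc t^_ c m ⟩
    K t^_ (suc c) m ⊕ q^ c ⊗ K (λ j → t ⊗ t^ j) c m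
      ≈⟨ ⊕-cong (K-t^ (suc c) m) (⊗-congˡ (≈-trans (K-cong (λ j → ≈-sym (⊕-identityˡ _)) c m)
           (≈-trans (K-linear (λ _ → 0#) t t^_ c m) (⊕-congʳ K-zero)))) ⟩
    (G (suc c + m) ⊕ t ⊗ K (shifted t^_) (suc c) m) ⊕ q^ c ⊗ (0# ⊕ t ⊗ K t^_ c m)
      ≈⟨ solution _ _ _ _ _ ⟩
    G (suc c + m) ⊕ t ⊗ (K (shifted t^_) (suc c) m ⊕ q^ c ⊗ K t^_ c m)
      ≈⟨ ⊕-cong (≈-reflexive (cong G (sym (+-suc c m)))) (⊗-congˡ (≈-sym (K-suc (shifted t^_) c m))) ⟩
    G (c + suc m) ⊕ t ⊗ K (shifted t^_) c (suc m) ∎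
    where
    solution = solve 5 (λ g t x p y → (g :+ t :* x) :+ p :* (con 0 :+ t :* y) := g :+ t :* (x :+ p :* y)) ≈-refl
    solution₀ = solve 3 (λ b p g → b :* (con 0 :* p :* g) := con 0) ≈-refl
    K-zero : K (λ _ → 0#) c m ≈ 0#
    K-zero = ≈-trans (∑²-cong m (λ j r _ → solution₀ _ _ _)) (∑-0 (antidiag m))

  -- From `H` the automaton climbs `j` letters at weight `t` each before it returns; the end of the
  -- word counts as a return, since `G 0` is 1. The recursion lowers `m` but raises `c`, so the
  -- induction keeps `c` general.
  U-closed : ∀ m c → U c m ≈ K t^_ c m
  U-closed = <-rec _ λ m ih c → begin
    U c m                              ≈⟨ U-step c m ⟩
    G (c + m) ⊕ t ⊗ S U c m            ≈⟨ ⊕-congˡ (⊗-congˡ (S-cong c m (λ c′ m′ p → ih p c′))) ⟩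
    G (c + m) ⊕ t ⊗ S (K t^_) c m      ≈⟨ ⊕-congˡ (⊗-congˡ (S-K t^_ c m)) ⟩
    G (c + m) ⊕ t ⊗ K (shifted t^_) c m ≈⟨ ≈-sym (K-t^ c m) ⟩
    K t^_ c m                          ∎

  -- `e` is the contribution of the increasing word that never leaves `F`; it exists only if no
  -- letter lies below the predecessor. `e₀` is its part from the empty word.
  e₀ e : ℕ → ℕ → Carrier
  e₀ zero zero    = 1#
  e₀ _    _       = 0#
  e zero    _     = 1#
  e (suc _) _     = 0#

  S-e-suc : ∀ c m → S e (suc c) m ≈ 0#
  S-e-suc c zero    = ≈-refl
  S-e-suc c (suc m) = ≈-trans (⊕-cong (S-e-suc (suc c) m) (zeroʳ _)) (⊕-identityˡ _)

  S-e-zero : ∀ m → S e 0 (suc m) ≈ 1#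
  S-e-zero m = ≈-trans (⊕-cong (S-e-suc 0 m) (⊗-identityˡ _)) (⊕-identityˡ _)

  e-step : ∀ c m → e₀ c m ⊕ S e c m ≈ e c m
  e-step zero    zero    = ⊕-identityʳ _
  e-step zero    (suc m) = ≈-trans (⊕-identityˡ _) (S-e-zero m)
  e-step (suc c) m       = ≈-trans (⊕-identityˡ _) (S-e-suc c m)

  V-step : ∀ c m → V c m ≈ e₀ c m ⊕ S (λ c m → V c m ⊕ t ⊗ U c m) c m
  V-step zero    zero    = ⊕-congʳ (⊗-identityˡ _)
  V-step zero    (suc m) = ≈-trans (v-suc m 0 (suc m) refl)
    (≈-trans (∑-range-S (λ n i → v n i ⊕ t ⊗ u n i) m 0 (suc m) refl) (≈-sym (⊕-identityˡ _)))
  V-step (suc c) m       = ≈-trans (v-suc (c + m) (suc c) m refl)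
    (≈-trans (∑-range-S (λ n i → v n i ⊕ t ⊗ u n i) (c + m) (suc c) m refl) (≈-sym (⊕-identityˡ _)))

  t⟨⟩-shifted : ∀ j → shifted (λ j → t⟨⟩ j ⊕ t ⊗ t^ j) j ≈ t⟨⟩ j
  t⟨⟩-shifted zero    = ≈-sym (zeroʳ t)
  t⟨⟩-shifted (suc j) = ≈-sym (distribˡ t _ _)

  -- Before the first return, a run of `j` letters starts in `F` at weight 1 and spends its last `i`
  -- letters in `H`, with `i` between 1 and `j`; summing `t^ i` gives `t ⊗ ⟨ j ⟩`.
  V-closed : ∀ m c → V c m ≈ e c m ⊕ K t⟨⟩ c m
  V-closed = <-rec _ λ m ih c → begin
    V c m
      ≈⟨ V-step c m ⟩
    e₀ c m ⊕ S (λ c m → V c m ⊕ t ⊗ U c m) c m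
      ≈⟨ ⊕-congˡ (S-cong c m λ c′ m′ p → ≈-trans (⊕-cong (ih p c′) (⊗-congˡ (U-closed m′ c′)))
           (≈-trans (⊕-assoc _ _ _) (⊕-congˡ (≈-sym (K-linear t⟨⟩ t t^_ c′ m′))))) ⟩
    e₀ c m ⊕ S (λ c m → e c m ⊕ K (λ j → t⟨⟩ j ⊕ t ⊗ t^ j) c m) c m
      ≈⟨ ⊕-congˡ (≈-trans (S-⊕ _ _ c m) (⊕-congˡ (≈-trans (S-K _ c m) (K-cong t⟨⟩-shifted c m)))) ⟩
    e₀ c m ⊕ (S e c m ⊕ K t⟨⟩ c m)
      ≈⟨ ≈-trans (≈-sym (⊕-assoc _ _ _)) (⊕-congʳ (e-step c m)) ⟩
    e c m ⊕ K t⟨⟩ c m ∎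

  -- The first letter of a word is read for free, so a run of `suc j` letters has only the weight of
  -- `j` steps; this is the shift in `ω`.
  G-recurrence : ∀ n → G n ≈ 1# ⊕ (ω ⋆ G) n
  G-recurrence zero    = solution _
    where
    solution = solve 1 (λ g → con 1 :* con 1 :+ con 0 := con 1 :+ (con 1 :* (con 0 :* g) :+ con 0)) ≈-refl
  G-recurrence (suc n) = begin
    G (suc n)
      ≈⟨ G-suc n ⟩
    ∑ (range 0 (suc n)) (λ i → q^ i ⊗ v n i)
      ≈⟨ ∑-range-S v n 0 (suc n) refl ⟩
    S V 0 (suc n)
      ≈⟨ S-cong 0 (suc n) (λ c′ m′ _ → V-closed m′ c′) ⟩
    S (λ c m → e c m ⊕ K t⟨⟩ c m) 0 (suc n)
      ≈⟨ ≈-trans (S-⊕ _ _ 0 (suc n)) (⊕-cong (S-e-zero n) (S-K t⟨⟩ 0 (suc n))) ⟩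
    1# ⊕ K ω 0 (suc n)
      ≈⟨ ⊕-congˡ (∑²-cong (suc n) (λ j r _ → ⊗-congˡ (⊗-congʳ (⊗-identityʳ _)))) ⟩
    1# ⊕ (ω ⋆ G) (suc n) ∎

-- Automaton weights as γ-weights

module GammaExpansion {c ℓ : Level} (R : CommutativeRing c ℓ) (t q : CommutativeRing.Carrier R) where
  open FiniteSums R
  open QBinomial q
  open GammaSide R t q

  [1+t]^_ : ℕ → Carrier
  [1+t]^_ = pow R (1# ⊕ t)

  -- Whether the letter before a is larger than a determines which of F a l and
  -- F a l ⊕ t ⊗ H a l has a product formula.
  choices : Bool → ℕ → List ℕ → Carrier
  choices true  a l = F a l
  choices false a l = F a l ⊕ t ⊗ H a l

  steps : Bool → List ℕ → ℕ
  steps true  l = length l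
  steps false l = suc (length l)

  ProductFormula : Bool → Ext → ℕ → List ℕ → Set ℓ
  ProductFormula x p a l =
    (ddFrom p (a ∷ l) ≡ 0 × ∃ λ m → des (a ∷ l) + des (a ∷ l) + m ≡ steps x l ×
      choices x a l ≈ t^ des (a ∷ l) ⊗ [1+t]^ m)
    ⊎ (ddFrom p (a ∷ l) ≢ 0 × choices x a l ≈ 0#)

  -- After an ascent both states are open: a following descent selects the branch with `t`, while a
  -- following ascent or the end of the word leaves a factor `1# ⊕ t`. After a descent, or at the
  -- start, only `F` is open and a descent gives 0. So each descent uses up two of the `steps`, and
  -- the other `m` are free.
  productFormula : ∀ x p a l → (fin a <ᴱ p) ≡ x → ProductFormula x p a l
  productFormula true  p a [] e rewrite e = inj₁ (refl , 0 , refl , ≈-sym (⊗-identityˡ _))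
  productFormula false p a [] e rewrite e = inj₁ (refl , 1 , refl , solution _)
    where
    solution = solve 1 (λ t → con 1 :+ t :* con 1 := con 1 :* ((con 1 :+ t) :* con 1)) ≈-refl
  productFormula true p a (b ∷ l) e with b <ᵇ a in eq
  ... | true rewrite e = inj₂ ((λ ()) , ≈-refl)
  ... | false rewrite e = productFormula false (fin a) b l eq
  productFormula false p a (b ∷ l) e with b <ᵇ a in eq
  ... | true rewrite e with productFormula true (fin a) b l eq
  ...   | inj₁ (d , m , h , v) = inj₁ (d , m , cong suc (trans (cong (_+ m) (+-suc _ _)) (cong suc h)) ,
            ≈-trans (⊕-identityˡ _) (≈-trans (⊗-congˡ v) (≈-sym (⊗-assoc _ _ _))))
  ...   | inj₂ (d , v) = inj₂ (d , ≈-trans (⊕-identityˡ _) (≈-trans (⊗-congˡ v) (zeroʳ _)))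
  productFormula false p a (b ∷ l) e | false rewrite e with productFormula false (fin a) b l eq
  ...   | inj₁ (d , m , h , v) = inj₁ (d , suc m , trans (+-suc _ m) (cong suc h) ,
            ≈-trans (⊕-cong v (⊗-congˡ v)) (solution _ _ _))
    where
    solution = solve 3 (λ t x y → x :* y :+ t :* (x :* y) := x :* ((con 1 :+ t) :* y)) ≈-refl
  ...   | inj₂ (d , v) = inj₂ (d , ≈-trans (⊕-cong v (≈-trans (⊗-congˡ v) (zeroʳ _))) (⊕-identityˡ _))

  ∑-applyUpTo-suc : ∀ N (g : ℕ → Carrier) → ∑ (applyUpTo suc N) g ≈ ∑ (upTo N) (g ∘ suc)
  ∑-applyUpTo-suc N g =
    ≈-trans (≈-reflexive (cong (λ l → ∑ l g) (sym (map-upTo suc N)))) (∑-map suc (upTo N) g)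

  ∑-upTo-select : ∀ N d (f : ℕ → Carrier) → d < N → ∑ (upTo N) (λ k → if d ≡ᵇ k then f k else 0#) ≈ f d
  ∑-upTo-select (suc N) zero    f _ = ≈-trans (⊕-congˡ (≈-trans (∑-applyUpTo-suc N (λ k → if 0 ≡ᵇ k then f k else 0#)) (∑-0 (upTo N)))) (⊕-identityʳ _)
  ∑-upTo-select (suc N) (suc d) f (s≤s d<N) = ≈-trans (⊕-identityˡ _)
    (≈-trans (∑-applyUpTo-suc N (λ k → if suc d ≡ᵇ k then f k else 0#)) (∑-upTo-select N d (f ∘ suc) d<N))

  gammaSide≈G : ∀ n → gammaSide R (suc n) t q ≈ G (suc n)
  gammaSide≈G n = begin
    ∑ ks (λ k → ∑ (Dnk (suc n) k) (λ σ → q^ inv σ) ⊗ t^ k ⊗ [1+t]^ (n ∸ (k + k)))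
      ≈⟨ ∑-cong ks (λ {k} _ → expand k) ⟩
    ∑ ks (λ k → ∑ (perms (suc n)) (λ σ → term σ k))
      ≈⟨ ∑-swap ks (perms (suc n)) (λ k σ → term σ k) ⟩
    ∑ (perms (suc n)) (λ σ → ∑ ks (term σ))
      ≈⟨ ∑-cong (perms (suc n)) (λ σ∈ → collect (∈-perms⁻ (suc n) σ∈)) ⟩
    ∑ (perms (suc n)) (λ σ → q^ inv σ ⊗ W σ) ∎
    where
    ks : List ℕ
    ks = upTo (suc (n / 2))

    term : List ℕ → ℕ → Carrier
    term σ k = if (dd σ ≡ᵇ 0) ∧ (des σ ≡ᵇ k) then q^ inv σ ⊗ (t^ k ⊗ [1+t]^ (n ∸ (k + k))) else 0#

    if-⊗ : ∀ b x y → (if b then x else 0#) ⊗ y ≈ (if b then x ⊗ y else 0#)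
    if-⊗ true  x y = ≈-refl
    if-⊗ false x y = zeroˡ y

    expand : ∀ k → ∑ (Dnk (suc n) k) (λ σ → q^ inv σ) ⊗ t^ k ⊗ [1+t]^ (n ∸ (k + k)) ≈
      ∑ (perms (suc n)) (λ σ → term σ k)
    expand k = ≈-trans (⊗-assoc _ _ _) (≈-trans (⊗-congʳ (∑-filter _ (perms (suc n)) _))
      (≈-trans (∑-⊗ʳ (perms (suc n)) _ _) (∑-cong (perms (suc n)) (λ _ → if-⊗ _ _ _))))

    collect : ∀ {σ} → σ ↭ down (suc n) → ∑ ks (term σ) ≈ q^ inv σ ⊗ W σ
    collect {[]} p = contradiction (↭-sym p) ¬x∷xs↭[]
    collect {a ∷ l} p with productFormula true ∞ a l refl
    ... | inj₁ (d , m , h , v) rewrite d = ≈-trans (∑-upTo-select _ _ _ (s≤s des≤))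
        (⊗-congˡ (≈-trans (⊗-congˡ (≈-reflexive (cong [1+t]^_ (trans (cong (_∸ δ₂) (sym h′)) (m+n∸m≡n δ₂ m))))) (≈-sym v)))
      where
      δ₂ : ℕ
      δ₂ = des (a ∷ l) + des (a ∷ l)
      h′ : δ₂ + m ≡ n
      h′ = trans h (suc-injective (trans (↭-length p) (length-down (suc n))))
      -- Twice the number of descents is at most `n`, so the descent number of a permutation without
      -- double descents always lies in the range of summation.
      des≤ : des (a ∷ l) ≤ n / 2
      des≤ = ≤-trans (≤-reflexive (sym (m*n/n≡m (des (a ∷ l)) 2))) (/-monoˡ-≤ 2
        (≤-trans (≤-reflexive (trans (*-comm (des (a ∷ l)) 2) (cong (des (a ∷ l) +_) (+-identityʳ _))))
          (subst (δ₂ ≤_) h′ (m≤m+n δ₂ m))))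
    ... | inj₂ (d , v) = ≈-trans (vanish (dd (a ∷ l)) d) (≈-sym (≈-trans (⊗-congˡ v) (zeroʳ _)))
      where
      vanish : ∀ x → x ≢ 0 → ∑ ks (λ k → if (x ≡ᵇ 0) ∧ (des (a ∷ l) ≡ᵇ k) then q^ inv (a ∷ l) ⊗ (t^ k ⊗ [1+t]^ (n ∸ (k + k))) else 0#) ≈ 0#
      vanish zero    x≢0 = contradiction refl x≢0
      vanish (suc x) _   = ∑-0 ks

-- Words are now read from right to left: the head of a list of length n is the letter
-- in position n.  A letter is barred if it is an excedance (w = false) or a weak
-- excedance (w = true), and barred letters are smaller than unbarred ones.

bar : Bool → ℕ → ℕ → Bool
bar w i a = i <ᵇ (if w then suc a else a)

bars : Bool → List ℕ → ℕ
bars w []      = 0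
bars w (a ∷ l) = b2n (bar w (suc (length l)) a) + bars w l

barLess : Bool → Bool → ℕ → ℕ → Bool
barLess true  true  x y = x <ᵇ y
barLess true  false x y = true
barLess false true  x y = false
barLess false false x y = x <ᵇ y

-- There is a descent from the letter y in position n to the letter x in position n + 1.
descent : Bool → ℕ → ℕ → ℕ → Bool
descent w n x y = barLess (bar w (suc n) x) (bar w n y) x y

barMaj : Bool → List ℕ → ℕ
barMaj w []          = 0
barMaj w (x ∷ [])    = 0
barMaj w (x ∷ y ∷ l) = (if descent w (suc (length l)) x y then suc (length l) else 0) + barMaj w (y ∷ l)

majR : List ℕ → ℕ
majR []          = 0
majR (x ∷ [])    = 0
majR (x ∷ y ∷ l) = (if x <ᵇ y then suc (length l) else 0) + majR (y ∷ l)

excFrom-++ : ∀ i xs ys → excFrom i (xs ++ ys) ≡ excFrom i xs + excFrom (i + length xs) ys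
excFrom-++ i []       ys = cong (λ m → excFrom m ys) (sym (+-identityʳ i))
excFrom-++ i (x ∷ xs) ys = trans
  (cong (b2n (i <ᵇ x) +_) (trans (excFrom-++ (suc i) xs ys)
    (cong (λ m → excFrom (suc i) xs + excFrom m ys) (sym (+-suc i (length xs))))))
  (sym (+-assoc (b2n (i <ᵇ x)) _ _))

exc-reverse : ∀ l → exc (reverse l) ≡ bars false l
exc-reverse []      = refl
exc-reverse (a ∷ l) = begin
  exc (reverse (a ∷ l))                                             ≡⟨ cong exc (unfold-reverse a l) ⟩
  exc (reverse l ∷ʳ a)                                              ≡⟨ excFrom-++ 1 (reverse l) (a ∷ []) ⟩
  exc (reverse l) + (b2n (suc (length (reverse l)) <ᵇ a) + 0)       ≡⟨ cong₂ _+_ (exc-reverse l)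
    (trans (+-identityʳ _) (cong (λ m → b2n (suc m <ᵇ a)) (length-reverse l))) ⟩
  bars false l + b2n (suc (length l) <ᵇ a)                          ≡⟨ +-comm (bars false l) _ ⟩
  bars false (a ∷ l)                                                ∎
  where open ≡-Reasoning

majFrom-∷ʳ : ∀ i xs y x →
  majFrom i (xs ++ y ∷ x ∷ []) ≡ majFrom i (xs ++ y ∷ []) + (if x <ᵇ y then i + length xs else 0)
majFrom-∷ʳ i [] y x with x <ᵇ y
... | true  = refl
... | false = refl
majFrom-∷ʳ i (z ∷ []) y x = trans
  (cong ((if y <ᵇ z then i else 0) +_) (majFrom-∷ʳ (suc i) [] y x))
  (trans (sym (+-assoc (if y <ᵇ z then i else 0) 0 _))
    (cong (λ m → (if y <ᵇ z then i else 0) + 0 + (if x <ᵇ y then m else 0)) (sym (+-suc i 0))))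
majFrom-∷ʳ i (z ∷ z′ ∷ xs) y x = trans
  (cong ((if z′ <ᵇ z then i else 0) +_) (majFrom-∷ʳ (suc i) (z′ ∷ xs) y x))
  (trans (sym (+-assoc (if z′ <ᵇ z then i else 0) _ _))
    (cong (λ m → (if z′ <ᵇ z then i else 0) + majFrom (suc i) (z′ ∷ xs ++ y ∷ []) + (if x <ᵇ y then m else 0))
      (sym (+-suc i (suc (length xs))))))

maj-reverse : ∀ l → maj (reverse l) ≡ majR l
maj-reverse []          = refl
maj-reverse (x ∷ [])    = refl
maj-reverse (x ∷ y ∷ l) = begin
  maj (reverse (x ∷ y ∷ l))                    ≡⟨ cong maj (trans (unfold-reverse x (y ∷ l))
    (trans (cong (_∷ʳ x) (unfold-reverse y l)) (++-assoc (reverse l) _ _))) ⟩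
  maj (reverse l ++ y ∷ x ∷ [])                ≡⟨ majFrom-∷ʳ 1 (reverse l) y x ⟩
  maj (reverse l ++ y ∷ []) + (if x <ᵇ y then suc (length (reverse l)) else 0)
    ≡⟨ cong₂ _+_ (trans (cong maj (sym (unfold-reverse y l))) (maj-reverse (y ∷ l)))
         (cong (λ m → if x <ᵇ y then suc m else 0) (length-reverse l)) ⟩
  majR (y ∷ l) + (if x <ᵇ y then suc (length l) else 0) ≡⟨ +-comm (majR (y ∷ l)) _ ⟩
  majR (x ∷ y ∷ l)                             ∎
  where open ≡-Reasoning

<ᵇ-true⁻ : ∀ {a b} → (a <ᵇ b) ≡ true → a < b
<ᵇ-true⁻ {a} {b} e = <ᵇ⇒< a b (subst T (sym e) tt)

<ᵇ-false⁻ : ∀ {a b} → (a <ᵇ b) ≡ false → b ≤ a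
<ᵇ-false⁻ {a} {b} e with a <? b
... | yes a<b = case trans (sym e) (<ᵇ-true a<b) of λ ()
... | no a≮b  = ≮⇒≥ a≮b

-- Barring turns a maximal run of excedances in positions i + 1, …, j into the descent set
-- change that removes j and adds i, hence lowers maj by the length of the run.
majR-barMaj : ∀ a l → Unique (a ∷ l) →
  majR (a ∷ l) + (if bar false (suc (length l)) a then suc (length l) else 0) ≡
  bars false (a ∷ l) + barMaj false (a ∷ l)
majR-barMaj a [] _ with 1 <ᵇ a
... | true  = refl
... | false = refl
majR-barMaj x (y ∷ l) ((x≢y ∷ _) ∷ u)
  with bar false (suc (suc (length l))) x in ex | bar false (suc (length l)) y in ey | majR-barMaj y l u
... | true | true | ih = trans (lemma₁ (if x <ᵇ y then n else 0) (majR (y ∷ l)) n)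
    (trans (cong (λ m → suc ((if x <ᵇ y then n else 0) + m)) ih)
      (lemma₂ (if x <ᵇ y then n else 0) (bars false l) (barMaj false (y ∷ l))))
  where
  n = suc (length l)
  lemma₁ : ∀ k m n → k + m + suc n ≡ suc (k + (m + n))
  lemma₁ = ℕ-solve-∀
  lemma₂ : ∀ k m n → suc (k + (suc m + n)) ≡ suc (suc m + (k + n))
  lemma₂ = ℕ-solve-∀
... | true | false | ih
  rewrite <ᵇ-false {x} {y} (≤-trans (<ᵇ-false⁻ {suc (length l)} ey) (<⇒≤ (<⇒≤ (<ᵇ-true⁻ {b = x} ex)))) =
    trans (lemma₁ (majR (y ∷ l)) n) (trans (cong (λ m → suc (n + m)) ih) (lemma₂ n (bars false l) (barMaj false (y ∷ l))))
  where
  n = suc (length l)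
  lemma₁ : ∀ m n → m + suc n ≡ suc (n + (m + 0))
  lemma₁ = ℕ-solve-∀
  lemma₂ : ∀ k m n → suc (k + (m + n)) ≡ suc m + (k + n)
  lemma₂ = ℕ-solve-∀
... | false | true | ih
  rewrite <ᵇ-true {x} {y} (≤∧≢⇒< (≤-trans (<ᵇ-false⁻ {suc (suc (length l))} ex) (<ᵇ-true⁻ {b = y} ey)) x≢y) =
    trans (lemma₁ n (majR (y ∷ l))) ih
  where
  n = suc (length l)
  lemma₁ : ∀ n m → n + m + 0 ≡ m + n
  lemma₁ = ℕ-solve-∀
... | false | false | ih = trans (+-assoc (if x <ᵇ y then n else 0) _ 0)
    (trans (cong ((if x <ᵇ y then n else 0) +_) ih) (x∙yz≈y∙xz (if x <ᵇ y then n else 0) (bars false l) _))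
  where
  n = suc (length l)

-- The correction term of `majR-barMaj` belongs to a run of excedances reaching the end of the word;
-- a letter of [n] in position `n` cannot be an excedance.
majR≡bars+barMaj : ∀ n {l} → l ↭ down n → majR l ≡ bars false l + barMaj false l
majR≡bars+barMaj n {[]} p = refl
majR≡bars+barMaj n {a ∷ l} p = trans (sym (+-identityʳ _))
  (trans (cong (λ b → majR (a ∷ l) + (if b then suc (length l) else 0)) (sym unbarred))
    (majR-barMaj a l (unique-↭ (↭-sym p) (down-unique n))))
  where
  unbarred : bar false (suc (length l)) a ≡ false
  unbarred = <ᵇ-false (≤-trans (proj₂ (∈-down⁻ (∈-resp-↭ p (here refl))))
    (≤-reflexive (trans (sym (length-down n)) (sym (↭-length p)))))

maj∸exc-reverse : ∀ n {l} → l ↭ down n → maj (reverse l) ∸ exc (reverse l) ≡ barMaj false l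
maj∸exc-reverse n {l} p = trans
  (cong₂ _∸_ (trans (maj-reverse l) (majR≡bars+barMaj n p)) (exc-reverse l))
  (m+n∸m≡n (bars false l) (barMaj false l))

-- Rotating the values turns weak excedances into excedances

rot : ℕ → ℕ → ℕ
rot N a = if a ≡ᵇ N then 1 else suc a

≡ᵇ-true : ∀ a → (a ≡ᵇ a) ≡ true
≡ᵇ-true a = Equivalence.to T-≡ (≡⇒≡ᵇ a a refl)

≡ᵇ-false : ∀ {a b} → a ≢ b → (a ≡ᵇ b) ≡ false
≡ᵇ-false {a} {b} a≢b with a ≡ᵇ b in e
... | false = refl
... | true  = contradiction (≡ᵇ⇒≡ a b (subst T (sym e) tt)) a≢b

rot-≡ : ∀ N → rot N N ≡ 1
rot-≡ N rewrite ≡ᵇ-true N = refl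

rot-≢ : ∀ {N a} → a ≢ N → rot N a ≡ suc a
rot-≢ a≢N rewrite ≡ᵇ-false a≢N = refl

map-rot-down : ∀ {N} n → n < N → map (rot N) (down n) ≡ map suc (down n)
map-rot-down zero    _   = refl
map-rot-down (suc n) n<N = cong₂ _∷_ (rot-≢ (<⇒≢ n<N)) (map-rot-down n (<⇒≤ n<N))

down-suc : ∀ n → 1 ∷ map suc (down n) ↭ down (suc n)
down-suc zero    = ↭-refl
down-suc (suc n) = ↭-trans (swap _ _ ↭-refl) (prep _ (down-suc n))

rot-down : ∀ n → map (rot (suc n)) (down (suc n)) ↭ down (suc n)
rot-down n = ↭-trans (↭-reflexive (cong₂ _∷_ (rot-≡ (suc n)) (map-rot-down n ≤-refl))) (down-suc n)

rot-injective : ∀ {N a b} → 1 ≤ a → 1 ≤ b → rot N a ≡ rot N b → a ≡ b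
rot-injective {N} {a} {b} 1≤a 1≤b e with a ≟ N | b ≟ N
... | yes refl | yes refl = refl
... | yes refl | no b≢N rewrite rot-≡ N | rot-≢ b≢N = contradiction (≤-trans 1≤b (≤-reflexive (sym (suc-injective e)))) λ ()
... | no a≢N | yes refl rewrite rot-≡ N | rot-≢ a≢N = contradiction (≤-trans 1≤a (≤-reflexive (suc-injective e))) λ ()
... | no a≢N | no b≢N rewrite rot-≢ a≢N | rot-≢ b≢N = suc-injective e

map-rot-injective : ∀ {N l l′} → All (1 ≤_) l → All (1 ≤_) l′ → map (rot N) l ≡ map (rot N) l′ → l ≡ l′
map-rot-injective []       []       e = refl
map-rot-injective (p ∷ ps) (r ∷ rs) e =
  cong₂ _∷_ (rot-injective p r (∷-injectiveˡ e)) (map-rot-injective ps rs (∷-injectiveʳ e))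

-- Rotation preserves the order of the barred alphabet. The letter `N` is always a weak excedance
-- and is the largest barred letter; it turns into an unbarred 1, the smallest unbarred letter, so
-- it keeps its place between the two kinds. All other letters keep their bars and grow by one.
descent-rot : ∀ {N n x y} → 1 ≤ n → suc n ≤ N → x ∈ down N → y ∈ down N → x ≢ y →
  descent true n x y ≡ descent false n (rot N x) (rot N y)
descent-rot {N} {suc n} {x} {y} _ n<N x∈ y∈ x≢y with x ≟ N | y ≟ N
... | yes refl | yes refl = contradiction refl x≢y
... | yes refl | no y≢N rewrite rot-≡ N | rot-≢ y≢N | <ᵇ-true n<N with n <ᵇ y
...   | true  = <ᵇ-false (proj₂ (∈-down⁻ y∈))
...   | false = sym (<ᵇ-true (proj₁ (∈-down⁻ y∈)))
descent-rot {N} {suc n} {x} {y} _ n<N x∈ y∈ x≢y | no x≢N | yes refl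
  rewrite rot-≡ N | rot-≢ x≢N | <ᵇ-true (<⇒≤ n<N) with suc n <ᵇ x
...   | true  = <ᵇ-true (≤∧≢⇒< (proj₂ (∈-down⁻ x∈)) x≢N)
...   | false = refl
descent-rot {N} {suc n} {x} {y} _ n<N x∈ y∈ x≢y | no x≢N | no y≢N
  rewrite rot-≢ x≢N | rot-≢ y≢N with suc n <ᵇ x | n <ᵇ y
...   | true  | true  = refl
...   | true  | false = refl
...   | false | true  = refl
...   | false | false = refl

barMaj-rot : ∀ N l → Unique l → All (_∈ down N) l → length l ≤ N →
  barMaj true l ≡ barMaj false (map (rot N) l)
barMaj-rot N []       _ _ _ = refl
barMaj-rot N (x ∷ []) _ _ _ = refl
barMaj-rot N (x ∷ y ∷ l) ((x≢y ∷ _) ∷ u) (x∈ ∷ y∈ ∷ al) le rewrite length-map (rot N) l =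
  cong₂ (λ b m → (if b then suc (length l) else 0) + m)
    (descent-rot (s≤s z≤n) le x∈ y∈ x≢y) (barMaj-rot N (y ∷ l) u (y∈ ∷ al) (<⇒≤ le))

bars-rot-∉ : ∀ N l → All (_≢ N) l → bars true l ≡ bars false (map (rot N) l)
bars-rot-∉ N []      _ = refl
bars-rot-∉ N (a ∷ l) (a≢N ∷ al) rewrite rot-≢ a≢N | length-map (rot N) l =
  cong (b2n (length l <ᵇ a) +_) (bars-rot-∉ N l al)

-- The single bar lost is that of `N`, whose image 1 is not an excedance.
bars-rot : ∀ N l → Unique l → N ∈ l → length l ≤ N → bars true l ≡ suc (bars false (map (rot N) l))
bars-rot N (a ∷ l) (a∉ ∷ u) (here refl) le
  rewrite rot-≡ a | <ᵇ-true le = cong suc (bars-rot-∉ a l (All.map (_∘ sym) a∉))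
bars-rot N (a ∷ l) (a∉ ∷ u) (there N∈) le
  rewrite rot-≢ (All.lookup a∉ N∈) | length-map (rot N) l =
  trans (cong (b2n (length l <ᵇ a) +_) (bars-rot N l u N∈ (<⇒≤ le))) (+-suc (b2n (length l <ᵇ a)) _)

-- Inserting fixed points: in a list of Booleans, true marks a fixed point

zeros ones : List Bool → ℕ
zeros []          = 0
zeros (true ∷ b)  = zeros b
zeros (false ∷ b) = suc (zeros b)
ones []           = 0
ones (true ∷ b)   = suc (ones b)
ones (false ∷ b)  = ones b

zeros+ones : ∀ b → zeros b + ones b ≡ length b
zeros+ones []          = refl
zeros+ones (true ∷ b)  = trans (+-suc _ _) (cong suc (zeros+ones b))
zeros+ones (false ∷ b) = cong suc (zeros+ones b)

zeroPositions onePositions : List Bool → List ℕ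
zeroPositions []          = []
zeroPositions (true ∷ b)  = zeroPositions b
zeroPositions (false ∷ b) = suc (length b) ∷ zeroPositions b
onePositions []           = []
onePositions (true ∷ b)   = suc (length b) ∷ onePositions b
onePositions (false ∷ b)  = onePositions b

length-zeroPositions : ∀ b → length (zeroPositions b) ≡ zeros b
length-zeroPositions []          = refl
length-zeroPositions (true ∷ b)  = length-zeroPositions b
length-zeroPositions (false ∷ b) = cong suc (length-zeroPositions b)

-- place b x is the position of the x-th zero of b, for x ≤ zeros b.
place : List Bool → ℕ → ℕ
place []          x = x
place (true ∷ b)  x = punch (length b) (place b x)
place (false ∷ b) x = place b x

place-monotone : ∀ b → StrictlyMonotone (place b)
place-monotone []          p = p
place-monotone (true ∷ b)  p = punch-monotone (length b) (place-monotone b p)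
place-monotone (false ∷ b) p = place-monotone b p

-- Past the zeros of `b` the map is a shift; its first value there is the position of a further zero
-- put in front of `b`, as the induction for `zeroPositions≡` requires.
place-> : ∀ b {x} → zeros b < x → place b x ≡ x + ones b
place-> []          p = sym (+-identityʳ _)
place-> (false ∷ b) p = place-> b (<⇒≤ p)
place-> (true ∷ b) {x} p = trans (cong (punch (length b)) (place-> b p))
  (trans (punch-> (subst (_< x + ones b) (zeros+ones b) (+-monoˡ-< (ones b) p))) (sym (+-suc x (ones b))))

place-suc-zeros : ∀ b → place b (suc (zeros b)) ≡ suc (length b)
place-suc-zeros b = trans (place-> b ≤-refl) (cong suc (zeros+ones b))

place-≤ : ∀ b {x} → x ≤ zeros b → place b x ≤ length b
place-≤ b p = ≤-pred (≤-trans (place-monotone b (s≤s p)) (≤-reflexive (place-suc-zeros b)))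

zeroPositions≡ : ∀ b → zeroPositions b ≡ map (place b) (down (zeros b))
zeroPositions≡ []          = refl
zeroPositions≡ (false ∷ b) = cong₂ _∷_ (sym (place-suc-zeros b)) (zeroPositions≡ b)
zeroPositions≡ (true ∷ b)  = trans (zeroPositions≡ b)
  (map-cong-local (All.tabulate λ x∈ → sym (punch-≤ (place-≤ b (proj₂ (∈-down⁻ x∈))))))

merge : List Bool → List ℕ → List ℕ
merge []          δ       = []
merge (true ∷ b)  δ       = suc (length b) ∷ merge b δ
merge (false ∷ b) []      = []
merge (false ∷ b) (d ∷ δ) = d ∷ merge b δ

length-merge : ∀ b δ → length δ ≡ zeros b → length (merge b δ) ≡ length b
length-merge []          δ       e = refl
length-merge (true ∷ b)  δ       e = cong suc (length-merge b δ e)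
length-merge (false ∷ b) (d ∷ δ) e = cong suc (length-merge b δ (suc-injective e))

merge-↭ : ∀ b δ → length δ ≡ zeros b → merge b δ ↭ onePositions b ++ δ
merge-↭ []          []      e = ↭-refl
merge-↭ (true ∷ b)  δ       e = prep _ (merge-↭ b δ e)
merge-↭ (false ∷ b) (d ∷ δ) e =
  ↭-trans (prep d (merge-↭ b δ (suc-injective e))) (↭-sym (shift d (onePositions b) δ))

merge-zeroPositions : ∀ b → merge b (zeroPositions b) ≡ down (length b)
merge-zeroPositions []          = refl
merge-zeroPositions (true ∷ b)  = cong (suc (length b) ∷_) (merge-zeroPositions b)
merge-zeroPositions (false ∷ b) = cong (suc (length b) ∷_) (merge-zeroPositions b)

-- Filling the zeros of `b` with their own positions yields the identity permutation, so this is a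
-- case of `merge-↭`.
down-↭ : ∀ b → down (length b) ↭ onePositions b ++ zeroPositions b
down-↭ b = subst (_↭ onePositions b ++ zeroPositions b) (merge-zeroPositions b)
  (merge-↭ b (zeroPositions b) (length-zeroPositions b))

fixbits : List ℕ → List Bool
fixbits []      = []
fixbits (a ∷ l) = (a ≡ᵇ suc (length l)) ∷ fixbits l

unfixed : List ℕ → List ℕ
unfixed []      = []
unfixed (a ∷ l) = if a ≡ᵇ suc (length l) then unfixed l else a ∷ unfixed l

length-fixbits : ∀ l → length (fixbits l) ≡ length l
length-fixbits []      = refl
length-fixbits (a ∷ l) = cong suc (length-fixbits l)

length-unfixed : ∀ l → length (unfixed l) ≡ zeros (fixbits l)
length-unfixed []      = refl
length-unfixed (a ∷ l) with a ≡ᵇ suc (length l)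
... | true  = length-unfixed l
... | false = cong suc (length-unfixed l)

merge-fixbits : ∀ l → merge (fixbits l) (unfixed l) ≡ l
merge-fixbits []      = refl
merge-fixbits (a ∷ l) with a ≡ᵇ suc (length l) in e
... | true  = cong₂ _∷_ (trans (cong suc (length-fixbits l)) (sym (≡ᵇ⇒≡ a _ (subst T (sym e) tt)))) (merge-fixbits l)
... | false = cong (a ∷_) (merge-fixbits l)

-- Letters are compared with their positions in the merged word, unlike in `Deranged`; this ensures
-- that merging creates no fixed point outside the marked ones.
DerangedAt : List Bool → List ℕ → Set
DerangedAt []          δ       = ⊤
DerangedAt (true ∷ b)  δ       = DerangedAt b δ
DerangedAt (false ∷ b) []      = ⊤
DerangedAt (false ∷ b) (d ∷ δ) = d ≢ suc (length b) × DerangedAt b δ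

derangedAt-fixbits : ∀ l → DerangedAt (fixbits l) (unfixed l)
derangedAt-fixbits []      = tt
derangedAt-fixbits (a ∷ l) with a ≡ᵇ suc (length l) in e
... | true  = derangedAt-fixbits l
... | false = (λ a≡ → subst T e (≡⇒≡ᵇ a (suc (length l)) (trans a≡ (cong suc (length-fixbits l))))) ,
              derangedAt-fixbits l

fixbits-merge : ∀ b δ → length δ ≡ zeros b → DerangedAt b δ → fixbits (merge b δ) ≡ b × unfixed (merge b δ) ≡ δ
fixbits-merge []         []      e d = refl , refl
fixbits-merge (true ∷ b) δ       e d
  rewrite length-merge b δ e | ≡ᵇ-true (length b) =
  let p , r = fixbits-merge b δ e d in cong (true ∷_) p , r
fixbits-merge (false ∷ b) (x ∷ δ) e (x≢ , d)
  rewrite length-merge b δ (suc-injective e) | ≡ᵇ-false x≢ =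
  let p , r = fixbits-merge b δ (suc-injective e) d in cong (false ∷_) p , cong (x ∷_) r

Deranged : List ℕ → Set
Deranged []      = ⊤
Deranged (d ∷ δ) = d ≢ suc (length δ) × Deranged δ

deranged? : ∀ δ → Dec (Deranged δ)
deranged? []      = yes tt
deranged? (d ∷ δ) = ¬? (d ≟ suc (length δ)) ×-dec deranged? δ

der : ℕ → List (List ℕ)
der k = filter deranged? (perms k)

bar-self : ∀ w i → bar w i i ≡ w
bar-self true  i = <ᵇ-true {i} ≤-refl
bar-self false i = <ᵇ-false {i} ≤-refl

module _ {f : ℕ → ℕ} (mono : StrictlyMonotone f) where

  -- Read along the zeros of b, the word map f δ is order isomorphic to δ.
  Aligned : List Bool → List ℕ → Set
  Aligned b δ = zeroPositions b ≡ map f (down (zeros b)) × length δ ≡ zeros b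

  aligned-head : ∀ b d δ → Aligned (false ∷ b) (d ∷ δ) → suc (length b) ≡ f (suc (length δ))
  aligned-head b d δ (z , e) = trans (∷-injectiveˡ z) (cong f (sym e))

  -- Only `b` and `δ` shrink, while `f` remains the relabelling of the whole word: the letters left
  -- in `δ` may exceed `zeros b`, where `place b` would be a different map.
  aligned-tail : ∀ b d δ → Aligned (false ∷ b) (d ∷ δ) → Aligned b δ
  aligned-tail b d δ (z , e) = ∷-injectiveʳ z , suc-injective e

  aligned-length : ∀ b δ → Aligned b δ → length (map f δ) ≡ zeros b
  aligned-length b δ (_ , e) = trans (length-map f δ) e

  length-merge-map : ∀ b δ → Aligned b δ → length (merge b (map f δ)) ≡ length b
  length-merge-map b δ al = length-merge b (map f δ) (aligned-length b δ al)

  derangedAt⁺ : ∀ b δ → Aligned b δ → Deranged δ → DerangedAt b (map f δ)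
  derangedAt⁺ []          δ       al d = tt
  derangedAt⁺ (true ∷ b)  δ       al d = derangedAt⁺ b δ al d
  derangedAt⁺ (false ∷ b) []      al d = tt
  derangedAt⁺ (false ∷ b) (x ∷ δ) al (x≢ , d) =
    (λ e → x≢ (monotone-injective mono (trans e (aligned-head b x δ al)))) ,
    derangedAt⁺ b δ (aligned-tail b x δ al) d

  derangedAt⁻ : ∀ b δ → Aligned b δ → DerangedAt b (map f δ) → Deranged δ
  derangedAt⁻ b           []      al d = tt
  derangedAt⁻ (true ∷ b)  (x ∷ δ) al d = derangedAt⁻ b (x ∷ δ) al d
  derangedAt⁻ (false ∷ b) (x ∷ δ) al (fx≢ , d) =
    (λ e → fx≢ (trans (cong f e) (sym (aligned-head b x δ al)))) ,
    derangedAt⁻ b δ (aligned-tail b x δ al) d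

  bar-monotone : ∀ w x y → bar w (f x) (f y) ≡ bar w x y
  bar-monotone false x y = monotone-<ᵇ mono x y
  bar-monotone true  x y with <-cmp x y
  ... | tri< x<y _ _  = trans (<ᵇ-true (m<n⇒m<1+n (mono x<y))) (sym (<ᵇ-true (m<n⇒m<1+n x<y)))
  ... | tri≈ _ refl _ = trans (<ᵇ-true {f x} ≤-refl) (sym (<ᵇ-true {x} ≤-refl))
  ... | tri> _ _ y<x  = trans (<ᵇ-false (mono y<x)) (sym (<ᵇ-false y<x))

  bar-aligned : ∀ w b d δ → Aligned (false ∷ b) (d ∷ δ) →
    bar w (suc (length b)) (f d) ≡ bar w (suc (length δ)) d
  bar-aligned w b d δ al =
    trans (cong (λ i → bar w i (f d)) (aligned-head b d δ al)) (bar-monotone w (suc (length δ)) d)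

  barLess-monotone : ∀ v w x y → barLess v w (f x) (f y) ≡ barLess v w x y
  barLess-monotone true  true  x y = monotone-<ᵇ mono x y
  barLess-monotone true  false x y = refl
  barLess-monotone false true  x y = refl
  barLess-monotone false false x y = monotone-<ᵇ mono x y

  bars-merge : ∀ w b δ → Aligned b δ → bars w (merge b (map f δ)) ≡ bars w δ + (if w then ones b else 0)
  bars-merge true  [] [] al = refl
  bars-merge false [] [] al = refl
  bars-merge true (true ∷ b) δ al
    rewrite length-merge-map b δ al | bar-self true (suc (length b)) =
    trans (cong suc (bars-merge true b δ al)) (sym (+-suc (bars true δ) (ones b)))
  bars-merge false (true ∷ b) δ al
    rewrite length-merge-map b δ al | bar-self false (suc (length b)) = bars-merge false b δ al
  bars-merge w (false ∷ b) (d ∷ δ) al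
    rewrite length-merge-map b δ (aligned-tail b d δ al) | bar-aligned w b d δ al =
    trans (cong (b2n (bar w (suc (length δ)) d) +_) (bars-merge w b δ (aligned-tail b d δ al)))
      (trans (sym (+-assoc (b2n (bar w (suc (length δ)) d)) _ _)) (cong (λ m → bars w (d ∷ δ) + m) (same w)))
    where
    same : ∀ w → (if w then ones b else 0) ≡ (if w then ones (false ∷ b) else 0)
    same true  = refl
    same false = refl

-- Each letter records whether a descent leads into it. The `false` of the letter in position 1 is a
-- filler, ignored by `descentSum`, which gives the list the length of the word.
descents : Bool → List ℕ → List Bool
descents w []          = []
descents w (x ∷ [])    = false ∷ []
descents w (x ∷ y ∷ l) = descent w (suc (length l)) x y ∷ descents w (y ∷ l)

length-descents : ∀ w l → length (descents w l) ≡ length l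
length-descents w []          = refl
length-descents w (x ∷ [])    = refl
length-descents w (x ∷ y ∷ l) = cong suc (length-descents w (y ∷ l))

descentSum : List Bool → ℕ
descentSum []            = 0
descentSum (e ∷ [])      = 0
descentSum (e ∷ e′ ∷ es) = (if e then suc (length es) else 0) + descentSum (e′ ∷ es)

descentSum-descents : ∀ w l → descentSum (descents w l) ≡ barMaj w l
descentSum-descents w []              = refl
descentSum-descents w (x ∷ [])        = refl
descentSum-descents w (x ∷ y ∷ [])    = refl
descentSum-descents w (x ∷ y ∷ z ∷ l) = cong₂ _+_
  (cong (λ m → if descent w (suc (suc (length l))) x y then suc m else 0) (length-descents w (z ∷ l)))
  (descentSum-descents w (y ∷ z ∷ l))

-- The statistic barMaj w of a word with fixed points b whose other letters have the
-- descents es: the comparison of a fixed point with a neighbour that is not fixed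
-- depends only on w.
mergeSum : Bool → List Bool → List Bool → ℕ
mergeSum w []                  es       = 0
mergeSum w (x ∷ [])            es       = 0
mergeSum w (true ∷ true ∷ b)   es       = mergeSum w (true ∷ b) es
mergeSum w (true ∷ false ∷ b)  es       = (if w then suc (length b) else 0) + mergeSum w (false ∷ b) es
mergeSum w (false ∷ x ∷ b)     []       = 0
mergeSum w (false ∷ true ∷ b)  (e ∷ es) = (if w then 0 else suc (length b)) + mergeSum w (true ∷ b) es
mergeSum w (false ∷ false ∷ b) (e ∷ es) = (if e then suc (length b) else 0) + mergeSum w (false ∷ b) es

descent-fixed-fixed : ∀ w n → descent w n (suc n) n ≡ false
descent-fixed-fixed true n
  rewrite <ᵇ-true {n} ≤-refl = <ᵇ-false {suc n} (n≤1+n n)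
descent-fixed-fixed false n
  rewrite <ᵇ-false {n} ≤-refl = <ᵇ-false {suc n} (n≤1+n n)

-- A barred fixed point is smaller, and an unbarred one larger, than a neighbour that is not fixed:
-- if the two agree in being barred or not, the neighbour lies beyond both positions on the side
-- given by its own status. Here `y ≢ suc n` holds because that value is taken by the fixed point.
descent-fixed-unfixed : ∀ w n {y} → y ≢ n → y ≢ suc n → descent w n (suc n) y ≡ w
descent-fixed-unfixed true n {y} y≢n y≢1+n
  rewrite <ᵇ-true {suc n} ≤-refl with n <ᵇ suc y in e
... | true  = <ᵇ-true (≤∧≢⇒< (≤∧≢⇒< (≤-pred (<ᵇ-true⁻ {n} {suc y} e)) (≢-sym y≢n)) (≢-sym y≢1+n))
... | false = refl
descent-fixed-unfixed false n {y} y≢n y≢1+n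
  rewrite <ᵇ-false {suc n} ≤-refl with n <ᵇ y in e
... | true  = refl
... | false = <ᵇ-false (m≤n⇒m≤1+n (<ᵇ-false⁻ {n} {y} e))

descent-unfixed-fixed : ∀ w n {x} → x ≢ n → x ≢ suc n → descent w n x n ≡ not w
descent-unfixed-fixed true n {x} x≢n x≢1+n
  rewrite <ᵇ-true {n} ≤-refl with suc n <ᵇ suc x in e
... | true  = <ᵇ-false (<⇒≤ (<ᵇ-true⁻ {n} {x} e))
... | false = refl
descent-unfixed-fixed false n {x} x≢n x≢1+n
  rewrite <ᵇ-false {n} ≤-refl with suc n <ᵇ x in e
... | true  = refl
... | false = <ᵇ-true (≤∧≢⇒< (≤-pred (≤∧≢⇒< (<ᵇ-false⁻ {suc n} {x} e) x≢1+n)) x≢n)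

if-not : ∀ {a} {X : Set a} w {x y : X} → (if not w then x else y) ≡ (if w then y else x)
if-not true  = refl
if-not false = refl

barMaj-merge : ∀ {f} (mono : StrictlyMonotone f) w b δ → Aligned mono b δ → Deranged δ →
  Unique (merge b (map f δ)) → barMaj w (merge b (map f δ)) ≡ mergeSum w b (descents w δ)
barMaj-merge mono w []           δ       al d u = refl
barMaj-merge mono w (true ∷ [])  δ       al d u = refl
barMaj-merge mono w (false ∷ []) (x ∷ δ) al d u = refl
barMaj-merge {f} mono w (true ∷ true ∷ b) δ al d (_ ∷ u)
  rewrite length-merge-map mono b δ al | descent-fixed-fixed w (suc (length b))
        | sym (barMaj-merge mono w (true ∷ b) δ al d u) = refl
barMaj-merge {f} mono w (true ∷ false ∷ b) (y ∷ δ) al d ((≢y ∷ _) ∷ u)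
  rewrite length-merge-map mono b δ (aligned-tail mono b y δ al)
        | descent-fixed-unfixed w (suc (length b)) (proj₁ (derangedAt⁺ mono (false ∷ b) (y ∷ δ) al d)) (≢-sym ≢y)
        | sym (barMaj-merge mono w (false ∷ b) (y ∷ δ) al d u) = refl
barMaj-merge {f} mono w (false ∷ true ∷ b) (x ∷ δ) al d ((x≢ ∷ _) ∷ u)
  with aligned-tail mono (true ∷ b) x δ al | derangedAt⁺ mono (false ∷ true ∷ b) (x ∷ δ) al d
... | al′ | x≢′ , _
  rewrite length-merge-map mono b δ al′
        | descent-unfixed-fixed w (suc (length b)) x≢ x≢′
        | if-not w {suc (length b)} {0} with δ
-- The case split only serves to unfold `descents w (x ∷ δ)`; its head is ignored by `mergeSum`,
-- since a fixed point precedes `x`.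
... | []     = cong ((if w then 0 else suc (length b)) +_) (barMaj-merge mono w (true ∷ b) [] al′ tt u)
... | y ∷ δ′ = cong ((if w then 0 else suc (length b)) +_) (barMaj-merge mono w (true ∷ b) (y ∷ δ′) al′ (proj₂ d) u)
barMaj-merge {f} mono w (false ∷ false ∷ b) (x ∷ y ∷ δ) al (_ , d) (_ ∷ u)
  with aligned-tail mono (false ∷ b) x (y ∷ δ) al
... | al′
  rewrite length-merge-map mono b δ (aligned-tail mono b y δ al′)
        | bar-aligned mono w (false ∷ b) x (y ∷ δ) al | bar-aligned mono w b y δ al′ =
  cong₂ (λ e m → (if e then suc (length b) else 0) + m)
    (barLess-monotone mono (bar w (suc (suc (length δ))) x) (bar w (suc (length δ)) y) x y) (barMaj-merge mono w (false ∷ b) (y ∷ δ) al′ d u)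

-- Permutations as derangements with inserted fixed points

bins : ℕ → ℕ → List (List Bool)
bins zero    zero    = [] ∷ []
bins zero    (suc j) = map (true ∷_) (bins zero j)
bins (suc k) zero    = map (false ∷_) (bins k zero)
bins (suc k) (suc j) = map (false ∷_) (bins k (suc j)) ++ map (true ∷_) (bins (suc k) j)

∈-bins⁺ : ∀ b → b ∈ bins (zeros b) (ones b)
∈-bins⁺ [] = here refl
∈-bins⁺ (true ∷ b) with zeros b | ∈-bins⁺ b
... | zero  | b∈ = ∈-map⁺ (true ∷_) b∈
... | suc k | b∈ = ∈-++⁺ʳ (map (false ∷_) (bins k _)) (∈-map⁺ (true ∷_) b∈)
∈-bins⁺ (false ∷ b) with ones b | ∈-bins⁺ b
... | zero  | b∈ = ∈-map⁺ (false ∷_) b∈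
... | suc j | b∈ = ∈-++⁺ˡ (∈-map⁺ (false ∷_) b∈)

∈-bins⁻ : ∀ k j {b} → b ∈ bins k j → zeros b ≡ k × ones b ≡ j
∈-bins⁻ zero zero (here refl) = refl , refl
∈-bins⁻ zero (suc j) b∈ with ∈-map⁻ (true ∷_) b∈
... | _ , b′∈ , refl = let p , r = ∈-bins⁻ zero j b′∈ in p , cong suc r
∈-bins⁻ (suc k) zero b∈ with ∈-map⁻ (false ∷_) b∈
... | _ , b′∈ , refl = let p , r = ∈-bins⁻ k zero b′∈ in cong suc p , r
∈-bins⁻ (suc k) (suc j) b∈ with ∈-++⁻ (map (false ∷_) (bins k (suc j))) b∈
... | inj₁ b∈₁ with ∈-map⁻ (false ∷_) b∈₁
...   | _ , b′∈ , refl = let p , r = ∈-bins⁻ k (suc j) b′∈ in cong suc p , r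
∈-bins⁻ (suc k) (suc j) b∈ | inj₂ b∈₂ with ∈-map⁻ (true ∷_) b∈₂
...   | _ , b′∈ , refl = let p , r = ∈-bins⁻ (suc k) j b′∈ in p , cong suc r

bins-length : ∀ k j {b} → b ∈ bins k j → length b ≡ k + j
bins-length k j {b} b∈ = let p , r = ∈-bins⁻ k j b∈ in trans (sym (zeros+ones b)) (cong₂ _+_ p r)

bins-unique : ∀ k j → Unique (bins k j)
bins-unique zero    zero    = [] ∷ []
bins-unique zero    (suc j) = Uniqueₚ.map⁺ ∷-injectiveʳ (bins-unique zero j)
bins-unique (suc k) zero    = Uniqueₚ.map⁺ ∷-injectiveʳ (bins-unique k zero)
bins-unique (suc k) (suc j) = Uniqueₚ.++⁺
  (Uniqueₚ.map⁺ ∷-injectiveʳ (bins-unique k (suc j)))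
  (Uniqueₚ.map⁺ ∷-injectiveʳ (bins-unique (suc k) j))
  λ (p , r) → let _ , _ , e = ∈-map⁻ _ p; _ , _ , e′ = ∈-map⁻ _ r in
    case ∷-injectiveˡ (trans (sym e) e′) of λ ()

assemble : List Bool × List ℕ → List ℕ
assemble (b , δ) = merge b (map (place b) δ)

place-aligned : ∀ b {δ} → δ ↭ down (zeros b) → Aligned (place-monotone b) b δ
place-aligned b p = zeroPositions≡ b , trans (↭-length p) (length-down (zeros b))

assemble-perm : ∀ b {δ} → δ ↭ down (zeros b) → assemble (b , δ) ↭ down (length b)
assemble-perm b {δ} p = begin
  merge b (map (place b) δ)                               ↭⟨ merge-↭ b _ (aligned-length (place-monotone b) b δ (place-aligned b p)) ⟩
  onePositions b ++ map (place b) δ                       ↭⟨ ++⁺ˡ (onePositions b) (map⁺ (place b) p) ⟩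
  onePositions b ++ map (place b) (down (zeros b))        ≡⟨ cong (onePositions b ++_) (sym (zeroPositions≡ b)) ⟩
  onePositions b ++ zeroPositions b                       ↭⟨ ↭-sym (down-↭ b) ⟩
  down (length b)                                         ∎
  where open PermutationReasoning

assemble-injective : ∀ {b b′ δ δ′} → δ ↭ down (zeros b) → Deranged δ → δ′ ↭ down (zeros b′) → Deranged δ′ →
  assemble (b , δ) ≡ assemble (b′ , δ′) → (b , δ) ≡ (b′ , δ′)
assemble-injective {b} {b′} {δ} {δ′} p d p′ d′ e
  with fixbits-merge b (map (place b) δ) (aligned-length (place-monotone b) b δ (place-aligned b p))
         (derangedAt⁺ (place-monotone b) b δ (place-aligned b p) d)
     | fixbits-merge b′ (map (place b′) δ′) (aligned-length (place-monotone b′) b′ δ′ (place-aligned b′ p′))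
         (derangedAt⁺ (place-monotone b′) b′ δ′ (place-aligned b′ p′) d′)
... | fb , fu | fb′ , fu′ with trans (sym fb) (trans (cong fixbits e) fb′)
... | refl = cong (b ,_) (map-injective (monotone-injective (place-monotone b))
  (trans (sym fu) (trans (cong unfixed e) fu′)))

assemble-onto : ∀ n {σ} → σ ↭ down n →
  ∃₂ λ b δ → length b ≡ n × δ ↭ down (zeros b) × Deranged δ × σ ≡ assemble (b , δ)
assemble-onto n {σ} p =
  let δ , unfixed≡ , r = ↭-map-inv (place b) (subst (_↭ unfixed σ) (zeroPositions≡ b) (↭-sym unfixed↭))
  in b , δ , length≡ , ↭-sym r ,
     derangedAt⁻ (place-monotone b) b δ (place-aligned b (↭-sym r))
       (subst (DerangedAt b) unfixed≡ (derangedAt-fixbits σ)) ,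
     trans (sym (merge-fixbits σ)) (cong (merge b) unfixed≡)
  where
  open PermutationReasoning
  b : List Bool
  b = fixbits σ
  length≡ : length b ≡ n
  length≡ = trans (length-fixbits σ) (trans (↭-length p) (length-down n))
  -- The fixed letters are exactly the marked positions; cancelling them from both rearrangements of
  -- [n] leaves the unfixed letters against the unmarked positions.
  unfixed↭ : unfixed σ ↭ zeroPositions b
  unfixed↭ = ++-cancelˡ-↭ (onePositions b) (begin
    onePositions b ++ unfixed σ         ↭⟨ ↭-sym (merge-↭ b (unfixed σ) (length-unfixed σ)) ⟩
    merge b (unfixed σ)                 ≡⟨ merge-fixbits σ ⟩
    σ                                   ↭⟨ p ⟩
    down n                              ≡⟨ cong down (sym length≡) ⟩
    down (length b)                     ↭⟨ down-↭ b ⟩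
    onePositions b ++ zeroPositions b   ∎)

bar-deranged : ∀ w {i a} → a ≢ i → bar w i a ≡ bar false i a
bar-deranged false a≢i = refl
bar-deranged true {i} {a} a≢i with <-cmp i a
... | tri< i<a _ _ = trans (<ᵇ-true (m<n⇒m<1+n i<a)) (sym (<ᵇ-true i<a))
... | tri≈ _ i≡a _ = contradiction (sym i≡a) a≢i
... | tri> _ _ a<i = trans (<ᵇ-false a<i) (sym (<ᵇ-false (<⇒≤ a<i)))

bars-deranged : ∀ w δ → Deranged δ → bars w δ ≡ bars false δ
bars-deranged w []      _        = refl
bars-deranged w (a ∷ δ) (a≢ , d) = cong₂ _+_ (cong b2n (bar-deranged w a≢)) (bars-deranged w δ d)

barMaj-deranged : ∀ w δ → Deranged δ → barMaj w δ ≡ barMaj false δ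
barMaj-deranged w []          _ = refl
barMaj-deranged w (x ∷ [])    _ = refl
barMaj-deranged w (x ∷ y ∷ δ) (x≢ , y≢ , d) = cong₂ _+_
  (cong₂ (λ v v′ → if barLess v v′ x y then suc (length δ) else 0) (bar-deranged w x≢) (bar-deranged w y≢))
  (barMaj-deranged w (y ∷ δ) (y≢ , d))

-- The q-binomial factor from inserting fixed points

module ExcedanceSide {c ℓ : Level} (R : CommutativeRing c ℓ) (q : CommutativeRing.Carrier R) where
  open FiniteSums R
  open QBinomial q

  ∑-bins-suc : ∀ k j f → ∑ (bins (suc k) (suc j)) f ≈
    ∑ (bins k (suc j)) (f ∘ (false ∷_)) ⊕ ∑ (bins (suc k) j) (f ∘ (true ∷_))
  ∑-bins-suc k j f = ≈-trans (∑-++ (map (false ∷_) (bins k (suc j))) _ f)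
    (⊕-cong (∑-map (false ∷_) (bins k (suc j)) f) (∑-map (true ∷_) (bins (suc k) j) f))

  ∑-bins-length : ∀ k j (h : ℕ → ℕ) (g : List Bool → ℕ) →
    ∑ (bins k j) (λ b → q^ (h (length b) + g b)) ≈ q^ h (k + j) ⊗ ∑ (bins k j) (λ b → q^ g b)
  ∑-bins-length k j h g = ≈-trans
    (∑-cong (bins k j) (λ {b} b∈ → ≈-trans
      (≈-reflexive (cong (λ m → q^ (h m + g b)) (bins-length k j b∈))) (pow-+ q (h (k + j)) (g b))))
    (≈-sym (∑-⊗ˡ (bins k j) _ _))

  -- X sums over the insertions of j fixed points into a word with descents es, X₀ and X₁ over
  -- those followed by a last letter that is not fixed (the head of es), respectively fixed.
  X X₀ X₁ : Bool → List Bool → ℕ → Carrier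
  X  w es j = ∑ (bins (length es) j) (λ b → q^ mergeSum w b es)
  X₁ w es j = ∑ (bins (length es) j) (λ b → q^ mergeSum w (true ∷ b) es)
  X₀ w []       j = 0#
  X₀ w (e ∷ es) j = ∑ (bins (length es) j) (λ b → q^ mergeSum w (false ∷ b) (e ∷ es))

  X-suc : ∀ w e es j → X w (e ∷ es) (suc j) ≈ X₀ w (e ∷ es) (suc j) ⊕ X₁ w (e ∷ es) j
  X-suc w e es j = ∑-bins-suc (length es) j _

  X-zero : ∀ w e es → X w (e ∷ es) 0 ≈ X₀ w (e ∷ es) 0
  X-zero w e es = ∑-map (false ∷_) (bins (length es) 0) _

  X-[] : ∀ w j → X w [] (suc j) ≈ X₁ w [] j
  X-[] w j = ∑-map (true ∷_) (bins 0 j) _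

  X₀-zero : ∀ w e e′ es →
    X₀ w (e ∷ e′ ∷ es) 0 ≈ q^ (if e then suc (length es + 0) else 0) ⊗ X₀ w (e′ ∷ es) 0
  X₀-zero w e e′ es = ≈-trans (∑-map (false ∷_) (bins (length es) 0) _)
    (∑-bins-length (length es) 0 (λ m → if e then suc m else 0) (λ b → mergeSum w (false ∷ b) (e′ ∷ es)))

  X₀-[] : ∀ w e j → X₀ w (e ∷ []) (suc j) ≈ q^ (if w then 0 else suc j) ⊗ X₁ w [] j
  X₀-[] w e j = ≈-trans (∑-map (true ∷_) (bins 0 j) _)
    (∑-bins-length 0 j (λ m → if w then 0 else suc m) (λ b → mergeSum w (true ∷ b) []))

  X₀-suc : ∀ w e e′ es j → X₀ w (e ∷ e′ ∷ es) (suc j) ≈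
    q^ (if e then suc (length es + suc j) else 0) ⊗ X₀ w (e′ ∷ es) (suc j)
      ⊕ q^ (if w then 0 else suc (suc (length es) + j)) ⊗ X₁ w (e′ ∷ es) j
  X₀-suc w e e′ es j = ≈-trans (∑-bins-suc (length es) j _) (⊕-cong
    (∑-bins-length (length es) (suc j) (λ m → if e then suc m else 0) (λ b → mergeSum w (false ∷ b) (e′ ∷ es)))
    (∑-bins-length (suc (length es)) j (λ m → if w then 0 else suc m) (λ b → mergeSum w (true ∷ b) (e′ ∷ es))))

  X₁-[] : ∀ w j → X₁ w [] (suc j) ≈ X₁ w [] j
  X₁-[] w j = ∑-map (true ∷_) (bins 0 j) _

  X₁-zero : ∀ w e es → X₁ w (e ∷ es) 0 ≈ q^ (if w then suc (length es + 0) else 0) ⊗ X₀ w (e ∷ es) 0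
  X₁-zero w e es = ≈-trans (∑-map (false ∷_) (bins (length es) 0) _)
    (∑-bins-length (length es) 0 (λ m → if w then suc m else 0) (λ b → mergeSum w (false ∷ b) (e ∷ es)))

  X₁-suc : ∀ w e es j → X₁ w (e ∷ es) (suc j) ≈
    q^ (if w then suc (length es + suc j) else 0) ⊗ X₀ w (e ∷ es) (suc j) ⊕ X₁ w (e ∷ es) j
  X₁-suc w e es j = ≈-trans (∑-bins-suc (length es) j _) (⊕-congʳ
    (∑-bins-length (length es) (suc j) (λ m → if w then suc m else 0) (λ b → mergeSum w (false ∷ b) (e ∷ es))))

  -- An unbarred fixed point at the end exceeds the letter before it and so creates no descent.
  X₁-strict : ∀ es j → X₁ false es j ≈ X false es j
  X₁-strict es j = ∑-cong (bins (length es) j) (λ {b} _ → ≈-reflexive (cong q^_ (drop-fixed b)))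
    where
    drop-fixed : ∀ b → mergeSum false (true ∷ b) es ≡ mergeSum false b es
    drop-fixed []          = refl
    drop-fixed (true ∷ b)  = refl
    drop-fixed (false ∷ b) = refl

  q^+ : ∀ m n → q^ (m + suc n) ≈ q^ m ⊗ q^ suc n
  q^+ m n = pow-+ q m (suc n)

  -- Fixed points act as copies of one letter larger than all others, so this is a MacMahon-type
  -- count. The induction needs the refinement `X₀-strict` by the last letter, and the two parts
  -- recombine by `B-pascal`.
  X-strict : ∀ es j → X false es j ≈ B (length es) j ⊗ q^ descentSum es
  X₀-strict : ∀ e es j → X₀ false (e ∷ es) j ≈ q^ j ⊗ (B (length es) j ⊗ q^ descentSum (e ∷ es))

  X-strict []       zero    = solve 0 (con 1 :+ con 0 := con 1 :* con 1) ≈-refl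
  X-strict []       (suc j) = ≈-trans (X-[] false j) (≈-trans (X₁-strict [] j) (X-strict [] j))
  X-strict (e ∷ es) zero    = ≈-trans (X-zero false e es)
    (≈-trans (X₀-strict e es 0) (≈-trans (⊗-identityˡ _) (⊗-congʳ (B-zeroʳ (length es)))))
  X-strict (e ∷ es) (suc j) = ≈-trans (X-suc false e es j)
    (≈-trans (⊕-cong (X₀-strict e es (suc j)) (≈-trans (X₁-strict (e ∷ es) j) (X-strict (e ∷ es) j)))
    (≈-trans (solution _ _ _ _) (⊗-congʳ (≈-sym (B-pascal (length es) j)))))
    where
    solution = solve 4 (λ p b d b′ → p :* (b :* d) :+ b′ :* d := (p :* b :+ b′) :* d) ≈-refl

  X₀-strict e [] zero    = solve 0 (con 1 :+ con 0 := con 1 :* (con 1 :* con 1)) ≈-refl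
  X₀-strict e [] (suc j) = ≈-trans (X₀-[] false e j) (⊗-congˡ (≈-trans (X₁-strict [] j) (X-strict [] j)))
  X₀-strict e (e′ ∷ es) zero = ≈-trans (X₀-zero false e e′ es)
    (≈-trans (⊗-cong (≈-reflexive (cong (λ m → q^ (if e then suc m else 0)) (+-identityʳ (length es)))) (X₀-strict e′ es 0))
    (≈-trans (⊗-congˡ (⊗-congˡ (⊗-congʳ (B-zeroʳ (length es)))))
    (≈-trans (solution _ _) (⊗-congˡ (⊗-congˡ (≈-sym (pow-+ q (if e then suc (length es) else 0) _)))))))
    where
    solution = solve 2 (λ p d → p :* (con 1 :* (con 1 :* d)) := con 1 :* (con 1 :* (p :* d))) ≈-refl
  X₀-strict true (e′ ∷ es) (suc j) = ≈-trans (X₀-suc false true e′ es j)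
    (≈-trans (⊕-cong
      (⊗-cong (q^+ (suc (length es)) j) (X₀-strict e′ es (suc j)))
      (⊗-cong (≈-trans (≈-reflexive (cong (λ m → q^ suc m) (sym (+-suc (length es) j)))) (q^+ (suc (length es)) j))
        (≈-trans (X₁-strict (e′ ∷ es) j) (X-strict (e′ ∷ es) j))))
    (≈-trans (solution _ _ _ _ _)
      (⊗-congˡ (⊗-cong (≈-sym (B-pascal (length es) j)) (≈-sym (pow-+ q (suc (length es)) _))))))
    where
    solution = solve 5 (λ p r b d b′ → p :* r :* (r :* (b :* d)) :+ p :* r :* (b′ :* d) :=
      r :* ((r :* b :+ b′) :* (p :* d))) ≈-refl
  X₀-strict false (e′ ∷ es) (suc j) = ≈-trans (X₀-suc false false e′ es j)
    (≈-trans (⊕-cong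
      (⊗-congˡ (X₀-strict e′ es (suc j)))
      (⊗-cong (≈-trans (≈-reflexive (cong (λ m → q^ suc m) (sym (+-suc (length es) j)))) (q^+ (suc (length es)) j))
        (≈-trans (X₁-strict (e′ ∷ es) j) (X-strict (e′ ∷ es) j))))
    (solution _ _ _ _ _))
    where
    solution = solve 5 (λ p r b d b′ → con 1 :* (r :* (b :* d)) :+ p :* r :* (b′ :* d) :=
      r :* ((b :+ p :* b′) :* d)) ≈-refl

  -- Barred fixed points act as copies of a smallest letter. Now a word ending in a fixed point
  -- carries the extra power and one ending otherwise carries none, so in `X-closed` the parts
  -- recombine by the defining rule of `B` and the total is the same as for unbarred ones.
  X₁-weak : ∀ es j → X₁ true es j ≈ q^ length es ⊗ (B (length es) j ⊗ q^ descentSum es)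
  X₀-weak : ∀ e es j → X₀ true (e ∷ es) j ≈ B (length es) j ⊗ q^ descentSum (e ∷ es)

  X₁-weak []       zero    = solve 0 (con 1 :+ con 0 := con 1 :* (con 1 :* con 1)) ≈-refl
  X₁-weak []       (suc j) = ≈-trans (X₁-[] true j) (X₁-weak [] j)
  X₁-weak (e ∷ es) zero    = ≈-trans (X₁-zero true e es)
    (⊗-cong (≈-reflexive (cong (λ m → q^ suc m) (+-identityʳ (length es))))
      (≈-trans (X₀-weak e es 0) (⊗-congʳ (B-zeroʳ (length es)))))
  X₁-weak (e ∷ es) (suc j) = ≈-trans (X₁-suc true e es j)
    (≈-trans (⊕-cong (⊗-cong (q^+ (suc (length es)) j) (X₀-weak e es (suc j))) (X₁-weak (e ∷ es) j))
    (≈-trans (solution _ _ _ _ _) (⊗-congˡ (⊗-congʳ (≈-sym (B-pascal (length es) j))))))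
    where
    solution = solve 5 (λ p r b d b′ → p :* r :* (b :* d) :+ p :* (b′ :* d) :=
      p :* ((r :* b :+ b′) :* d)) ≈-refl

  X₀-weak e [] zero    = solve 0 (con 1 :+ con 0 := con 1 :* con 1) ≈-refl
  X₀-weak e [] (suc j) = ≈-trans (X₀-[] true e j)
    (≈-trans (⊗-congˡ (X₁-weak [] j)) (≈-trans (⊗-identityˡ _) (⊗-identityˡ _)))
  X₀-weak e (e′ ∷ es) zero = ≈-trans (X₀-zero true e e′ es)
    (≈-trans (⊗-cong (≈-reflexive (cong (λ m → q^ (if e then suc m else 0)) (+-identityʳ (length es)))) (X₀-weak e′ es 0))
    (≈-trans (⊗-congˡ (⊗-congʳ (B-zeroʳ (length es))))
    (≈-trans (solution _ _) (⊗-congˡ (≈-sym (pow-+ q (if e then suc (length es) else 0) _))))))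
    where
    solution = solve 2 (λ p d → p :* (con 1 :* d) := con 1 :* (p :* d)) ≈-refl
  X₀-weak true (e′ ∷ es) (suc j) = ≈-trans (X₀-suc true true e′ es j)
    (≈-trans (⊕-cong
      (⊗-cong (q^+ (suc (length es)) j) (X₀-weak e′ es (suc j)))
      (⊗-congˡ (X₁-weak (e′ ∷ es) j)))
    (≈-trans (solution _ _ _ _ _)
      (⊗-cong (≈-sym (B-pascal (length es) j)) (≈-sym (pow-+ q (suc (length es)) _)))))
    where
    solution = solve 5 (λ p r b d b′ → p :* r :* (b :* d) :+ con 1 :* (p :* (b′ :* d)) :=
      (r :* b :+ b′) :* (p :* d)) ≈-refl
  X₀-weak false (e′ ∷ es) (suc j) = ≈-trans (X₀-suc true false e′ es j)
    (≈-trans (⊕-cong (⊗-congˡ (X₀-weak e′ es (suc j))) (⊗-congˡ (X₁-weak (e′ ∷ es) j))) (solution _ _ _ _))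
    where
    solution = solve 4 (λ p b d b′ → con 1 :* (b :* d) :+ con 1 :* (p :* (b′ :* d)) :=
      (b :+ p :* b′) :* d) ≈-refl

  X-closed : ∀ w es j → X w es j ≈ B (length es) j ⊗ q^ descentSum es
  X-closed false es       j       = X-strict es j
  X-closed true  []       zero    = solve 0 (con 1 :+ con 0 := con 1 :* con 1) ≈-refl
  X-closed true  []       (suc j) = ≈-trans (X-[] true j) (≈-trans (X₁-weak [] j) (⊗-identityˡ _))
  X-closed true  (e ∷ es) zero    = ≈-trans (X-zero true e es)
    (≈-trans (X₀-weak e es 0) (⊗-congʳ (B-zeroʳ (length es))))
  X-closed true  (e ∷ es) (suc j) = ≈-trans (X-suc true e es j)
    (≈-trans (⊕-cong (X₀-weak e es (suc j)) (X₁-weak (e ∷ es) j)) (solution _ _ _ _))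
    where
    solution = solve 4 (λ p b d b′ → b :* d :+ p :* (b′ :* d) := (b :+ p :* b′) :* d) ≈-refl

-- Sums over permutations reduced to sums over derangements

module ExcedanceSums {c ℓ : Level} (R : CommutativeRing c ℓ) (q : CommutativeRing.Carrier R) where
  open FiniteSums R
  open QBinomial q
  open ExcedanceSide R q

  -- The weight `τ` of the number of bars is left open: it is a power of `t` for the Eulerian
  -- polynomial and `⟨_⟩` for the comparison by rotation.
  P : Bool → (ℕ → Carrier) → ℕ → Carrier
  P w τ n = ∑ (perms n) (λ σ → τ (bars w σ) ⊗ q^ barMaj w σ)

  D : (ℕ → Carrier) → ℕ → Carrier
  D τ k = ∑ (der k) (λ δ → τ (bars false δ) ⊗ q^ barMaj false δ)

  markedOf : ℕ × ℕ → List (List Bool × List ℕ)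
  markedOf (k , j) = cartesianProduct (bins k j) (der k)

  marked : ℕ → List (List Bool × List ℕ)
  marked n = concatMap markedOf (antidiag n)

  marked-unique : ∀ n → Unique (marked n)
  marked-unique n = concatMap-unique {f = markedOf} (λ (b , _) → zeros b , ones b) (antidiag-unique n)
    (λ (k , j) → Uniqueₚ.cartesianProduct⁺ (bins-unique k j) (Uniqueₚ.filter⁺ deranged? (perms-unique k)))
    (λ {(k , j)} y∈ → let p , r = ∈-bins⁻ k j (proj₁ (∈-cartesianProduct⁻ (bins k j) (der k) y∈)) in cong₂ _,_ p r)

  ∈-der⁻ : ∀ k {δ} → δ ∈ der k → δ ↭ down k × Deranged δ
  ∈-der⁻ k δ∈ = let p , d = ∈-filter⁻ deranged? δ∈ in ∈-perms⁻ k p , d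

  ∈-marked⁻ : ∀ n {b δ} → (b , δ) ∈ marked n → length b ≡ n × δ ↭ down (zeros b) × Deranged δ
  ∈-marked⁻ n {b} {δ} x∈ with find (∈-concatMap⁻ markedOf x∈)
  ... | (k , j) , kj∈ , y∈ with ∈-cartesianProduct⁻ (bins k j) (der k) y∈
  ... | b∈ , δ∈ = trans (bins-length k j b∈) (∈-antidiag⁻ n kj∈) ,
        subst (λ m → δ ↭ down m) (sym (proj₁ (∈-bins⁻ k j b∈))) (proj₁ (∈-der⁻ k δ∈)) , proj₂ (∈-der⁻ k δ∈)

  ∈-marked⁺ : ∀ b {δ} → δ ↭ down (zeros b) → Deranged δ → (b , δ) ∈ marked (length b)
  ∈-marked⁺ b p d = ∈-concatMap⁺ markedOf
    (lose (subst (λ n → (zeros b , ones b) ∈ antidiag n) (zeros+ones b) (∈-antidiag⁺ (zeros b) (ones b)))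
      (∈-cartesianProduct⁺ (∈-bins⁺ b) (∈-filter⁺ deranged? (∈-perms⁺ (zeros b) p) d)))

  ∑-perms-marked : ∀ n f → ∑ (perms n) f ≈
    ∑² n (λ k j → ∑ (bins k j) (λ b → ∑ (der k) (λ δ → f (assemble (b , δ)))))
  ∑-perms-marked n f = begin
    ∑ (perms n) f
      ≈⟨ ≈-sym (∑-bijection assemble f (marked-unique n) (perms-unique n)
           (λ {(b , δ)} x∈ → let e , p , _ = ∈-marked⁻ n x∈ in
             ∈-perms⁺ n (subst (λ m → assemble (b , δ) ↭ down m) e (assemble-perm b p)))
           (λ x∈ y∈ → let _ , p , d = ∈-marked⁻ n x∈; _ , p′ , d′ = ∈-marked⁻ n y∈ in
             assemble-injective p d p′ d′)
           (λ y∈ → let b , δ , e , p , d , y≡ = assemble-onto n (∈-perms⁻ n y∈) in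
             (b , δ) , subst (λ m → (b , δ) ∈ marked m) e (∈-marked⁺ b p d) , y≡)) ⟩
    ∑ (marked n) (f ∘ assemble)
      ≈⟨ ∑-concatMap markedOf (antidiag n) _ ⟩
    ∑² n (λ k j → ∑ (cartesianProduct (bins k j) (der k)) (f ∘ assemble))
      ≈⟨ ∑²-cong n (λ k j _ → ∑-cartesianProduct (bins k j) (der k) _) ⟩
    ∑² n (λ k j → ∑ (bins k j) (λ b → ∑ (der k) (λ δ → f (assemble (b , δ))))) ∎

  -- The choice of `w` survives only in the number of bars, as the `q`-weight of the insertions is
  -- the same for both.
  P-derangements : ∀ w τ n → P w τ n ≈ ∑² n (λ k j → B k j ⊗ D (λ m → τ (m + (if w then j else 0))) k)
  P-derangements w τ n = ≈-trans (∑-perms-marked n _) (∑²-cong n (λ k j _ → inner k j))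
    where
    statistics : ∀ k j {b δ} → b ∈ bins k j → δ ∈ der k →
      τ (bars w (assemble (b , δ))) ⊗ q^ barMaj w (assemble (b , δ)) ≈
      τ (bars false δ + (if w then j else 0)) ⊗ q^ mergeSum w b (descents w δ)
    statistics k j {b} {δ} b∈ δ∈ with ∈-bins⁻ k j b∈ | ∈-der⁻ k δ∈
    ... | refl , refl | p , d = ≈-reflexive (cong₂ (λ x y → τ x ⊗ q^ y)
      (trans (bars-merge (place-monotone b) w b δ (place-aligned b p))
        (cong (_+ (if w then ones b else 0)) (bars-deranged w δ d)))
      (barMaj-merge (place-monotone b) w b δ (place-aligned b p) d
        (unique-↭ (↭-sym (assemble-perm b p)) (down-unique (length b)))))

    binsSum : ∀ k j {δ} → δ ∈ der k →
      ∑ (bins k j) (λ b → q^ mergeSum w b (descents w δ)) ≈ B k j ⊗ q^ barMaj false δ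
    binsSum k j {δ} δ∈ with ∈-der⁻ k δ∈
    ... | p , d with trans (length-descents w δ) (trans (↭-length p) (length-down k))
    ... | refl = ≈-trans (X-closed w (descents w δ) j)
      (⊗-congˡ (≈-reflexive (cong q^_ (trans (descentSum-descents w δ) (barMaj-deranged w δ d)))))

    solution = solve 3 (λ x b y → x :* (b :* y) := b :* (x :* y)) ≈-refl

    inner : ∀ k j →
      ∑ (bins k j) (λ b → ∑ (der k) (λ δ → τ (bars w (assemble (b , δ))) ⊗ q^ barMaj w (assemble (b , δ)))) ≈
      B k j ⊗ D (λ m → τ (m + (if w then j else 0))) k
    inner k j = begin
      ∑ (bins k j) (λ b → ∑ (der k) (λ δ → τ (bars w (assemble (b , δ))) ⊗ q^ barMaj w (assemble (b , δ))))
        ≈⟨ ∑-cong (bins k j) (λ b∈ → ∑-cong (der k) (λ δ∈ → statistics k j b∈ δ∈)) ⟩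
      ∑ (bins k j) (λ b → ∑ (der k) (λ δ → τ (bars false δ + (if w then j else 0)) ⊗ q^ mergeSum w b (descents w δ)))
        ≈⟨ ∑-swap (bins k j) (der k) _ ⟩
      ∑ (der k) (λ δ → ∑ (bins k j) (λ b → τ (bars false δ + (if w then j else 0)) ⊗ q^ mergeSum w b (descents w δ)))
        ≈⟨ ∑-cong (der k) (λ δ∈ → ≈-trans (≈-sym (∑-⊗ˡ (bins k j) _ _))
             (≈-trans (⊗-congˡ (binsSum k j δ∈)) (solution _ _ _))) ⟩
      ∑ (der k) (λ δ → B k j ⊗ (τ (bars false δ + (if w then j else 0)) ⊗ q^ barMaj false δ))
        ≈⟨ ≈-sym (∑-⊗ˡ (der k) _ _) ⟩
      B k j ⊗ D (λ m → τ (m + (if w then j else 0))) k ∎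

  P-rotation : ∀ τ n → P true τ (suc n) ≈ P false (τ ∘ suc) (suc n)
  P-rotation τ n = ≈-trans
    (∑-cong (perms N) (λ {σ} σ∈ → ≈-reflexive (let p = ∈-perms⁻ N σ∈ in
      cong₂ (λ x y → τ x ⊗ q^ y)
        (bars-rot N σ (unique p) (∈-resp-↭ (↭-sym p) (here refl)) (short p))
        (barMaj-rot N σ (unique p) (All.tabulate (∈-resp-↭ p)) (short p)))))
    (∑-bijection (map (rot N)) (λ σ → τ (suc (bars false σ)) ⊗ q^ barMaj false σ)
      (perms-unique N) (perms-unique N)
      (λ σ∈ → ∈-perms⁺ N (↭-trans (map⁺ (rot N) (∈-perms⁻ N σ∈)) (rot-down n)))
      (λ σ∈ σ′∈ → map-rot-injective (positive σ∈) (positive σ′∈))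
      (λ σ∈ → let ρ , e , p = ↭-map-inv (rot N) (↭-trans (rot-down n) (↭-sym (∈-perms⁻ N σ∈))) in
        ρ , ∈-perms⁺ N (↭-sym p) , e))
    where
    N : ℕ
    N = suc n
    unique : ∀ {σ} → σ ↭ down N → Unique σ
    unique p = unique-↭ (↭-sym p) (down-unique N)
    short : ∀ {σ} → σ ↭ down N → length σ ≤ N
    short p = ≤-reflexive (trans (↭-length p) (length-down N))
    positive : ∀ {σ} → σ ∈ perms N → All (1 ≤_) σ
    positive σ∈ = All.tabulate (λ a∈ → proj₁ (∈-down⁻ (∈-resp-↭ (∈-perms⁻ N σ∈) a∈)))

  A≈P : ∀ t n → A R n t 1# q ≈ P false (pow R t) n
  A≈P t n = ≈-trans
    (≈-sym (∑-bijection reverse _ (perms-unique n) (perms-unique n)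
      (λ σ∈ → ∈-perms⁺ n (↭-trans (↭-reverse _) (∈-perms⁻ n σ∈)))
      (λ _ _ → reverse-injective)
      (λ {σ} σ∈ → reverse σ , ∈-perms⁺ n (↭-trans (↭-reverse σ) (∈-perms⁻ n σ∈)) , sym (reverse-involutive σ))))
    (∑-cong (perms n) (λ {σ} σ∈ → ⊗-cong
      (≈-trans (⊗-cong (≈-reflexive (cong (pow R t) (exc-reverse σ))) (pow-1 (fix (reverse σ)))) (⊗-identityʳ _))
      (≈-reflexive (cong q^_ (maj∸exc-reverse n (∈-perms⁻ n σ∈))))))

-- The recurrence for derangements and the comparison of both sides

module Main {c ℓ : Level} (R : CommutativeRing c ℓ) (t q : CommutativeRing.Carrier R) where
  open FiniteSums R
  open QBinomial q
  open GammaSide R t q using (G; t^_)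
  open GammaRecurrence R t q using (⟨_⟩; ω; G-recurrence)
  open ExcedanceSums R q
  open import Algebra.Properties.Group (CommutativeRing.+-group R) using (∙-cancelˡ; ∙-cancelʳ)

  ⟨⟩-+ : ∀ m j → ⟨ m + j ⟩ ≈ ⟨ m ⟩ ⊕ t^ m ⊗ ⟨ j ⟩
  ⟨⟩-+ m zero    = ≈-trans (≈-reflexive (cong ⟨_⟩ (+-identityʳ m)))
    (≈-sym (≈-trans (⊕-congˡ (zeroʳ _)) (⊕-identityʳ _)))
  ⟨⟩-+ m (suc j) = ≈-trans (≈-reflexive (cong ⟨_⟩ (+-suc m j)))
    (≈-trans (⊕-cong (⟨⟩-+ m j) (pow-+ t m j)) (solution _ _ _ _))
    where
    solution = solve 4 (λ a p x y → (a :+ p :* x) :+ p :* y := a :+ p :* (x :+ y)) ≈-refl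

  ⟨suc⟩ : ∀ j → ⟨ suc j ⟩ ≈ 1# ⊕ t ⊗ ⟨ j ⟩
  ⟨suc⟩ j = ≈-trans (⟨⟩-+ 1 j) (⊕-cong (⊕-identityˡ _) (⊗-congʳ (⊗-identityʳ _)))

  one d a : ℕ → Carrier
  one _ = 1#
  d     = D t^_
  a     = D ⟨_⟩

  D-⟨⟩ : ∀ j k → D (λ m → ⟨ m + j ⟩) k ≈ a k ⊕ d k ⊗ ⟨ j ⟩
  D-⟨⟩ j k = ≈-trans
    (∑-cong (der k) (λ {δ} _ → ≈-trans (⊗-congʳ (⟨⟩-+ (bars false δ) j)) (solution _ _ _ _)))
    (≈-trans (∑-⊕ (der k) _ _) (⊕-congˡ (≈-sym (∑-⊗ʳ (der k) _ _))))
    where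
    solution = solve 4 (λ a p x y → (a :+ p :* x) :* y := a :* y :+ (p :* y) :* x) ≈-refl

  -- The sum `a ⋆ one` does not depend on `h`, so it cancels when two choices of `h` are compared:
  -- the number of fixed points for weak excedances, and 1 after rotation.
  ∑²-D-⟨⟩ : ∀ n (h : ℕ → ℕ) →
    ∑² n (λ k j → B k j ⊗ D (λ m → ⟨ m + h j ⟩) k) ≈ (a ⋆ one) n ⊕ (d ⋆ (⟨_⟩ ∘ h)) n
  ∑²-D-⟨⟩ n h = ≈-trans
    (∑²-cong n (λ k j _ → ≈-trans (⊗-congˡ (≈-trans (D-⟨⟩ (h j) k) (⊕-congʳ (≈-sym (⊗-identityʳ _))))) (distribˡ _ _ _)))
    (∑-⊕ (antidiag n) _ _)

  -- Weighting by ⟨ exc ⟩ instead of t^exc replaces a division by 1 - t.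
  d⋆⟨⟩ : ∀ n → (d ⋆ ⟨_⟩) (suc n) ≈ (d ⋆ one) (suc n)
  d⋆⟨⟩ n = ∙-cancelˡ ((a ⋆ one) (suc n)) _ _ (begin
    (a ⋆ one) (suc n) ⊕ (d ⋆ ⟨_⟩) (suc n)
      ≈⟨ ≈-sym (≈-trans (P-derangements true ⟨_⟩ (suc n)) (∑²-D-⟨⟩ (suc n) id)) ⟩
    P true ⟨_⟩ (suc n)
      ≈⟨ P-rotation ⟨_⟩ n ⟩
    P false (⟨_⟩ ∘ suc) (suc n)
      ≈⟨ ≈-trans (P-derangements false (⟨_⟩ ∘ suc) (suc n)) (∑²-cong (suc n) (λ k j _ → ⊗-congˡ (∑-cong (der k) (λ {δ} _ →
           ⊗-congʳ (≈-reflexive (cong ⟨_⟩ (trans (cong suc (+-identityʳ (bars false δ))) (+-comm 1 (bars false δ))))))))) ⟩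
    ∑² (suc n) (λ k j → B k j ⊗ D (λ m → ⟨ m + 1 ⟩) k)
      ≈⟨ ∑²-D-⟨⟩ (suc n) (λ _ → 1) ⟩
    (a ⋆ one) (suc n) ⊕ (d ⋆ (λ _ → ⟨ 1 ⟩)) (suc n)
      ≈⟨ ⊕-congˡ (⋆-cong (λ _ → ≈-refl) (λ _ → ⊕-identityˡ 1#) (suc n)) ⟩
    (a ⋆ one) (suc n) ⊕ (d ⋆ one) (suc n) ∎)

  -- This converts `d⋆⟨⟩` into the recurrence for `d`; the term `ε` makes up for `⟨ 0 ⟩` being 0.
  ⟨⟩⊕ε : ∀ j → ⟨ j ⟩ ⊕ ε j ≈ one j ⊕ ω j
  ⟨⟩⊕ε zero    = ⊕-comm _ _
  ⟨⟩⊕ε (suc j) = ≈-trans (⊕-identityʳ _) (⟨suc⟩ j)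

  d-recurrence : ∀ n → d n ≈ ε n ⊕ (d ⋆ ω) n
  d-recurrence zero    = solve 0 (con 1 :* con 1 :+ con 0 :=
    con 1 :+ (con 1 :* ((con 1 :* con 1 :+ con 0) :* con 0) :+ con 0)) ≈-refl
  d-recurrence (suc n) = ≈-sym (≈-trans (⊕-identityˡ _) (∙-cancelˡ ((d ⋆ one) (suc n)) _ _ (begin
    (d ⋆ one) (suc n) ⊕ (d ⋆ ω) (suc n)
      ≈⟨ ≈-sym (⋆-distribˡ d one ω (suc n)) ⟩
    (d ⋆ (λ j → one j ⊕ ω j)) (suc n)
      ≈⟨ ⋆-cong (λ _ → ≈-refl) (λ j → ≈-sym (⟨⟩⊕ε j)) (suc n) ⟩
    (d ⋆ (λ j → ⟨ j ⟩ ⊕ ε j)) (suc n)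
      ≈⟨ ⋆-distribˡ d ⟨_⟩ ε (suc n) ⟩
    (d ⋆ ⟨_⟩) (suc n) ⊕ (d ⋆ ε) (suc n)
      ≈⟨ ⊕-cong (d⋆⟨⟩ n) (⋆-identityʳ d (suc n)) ⟩
    (d ⋆ one) (suc n) ⊕ d (suc n) ∎)))

  -- The product `d ⋆ G` is expanded once through the recurrence for `G` and once through that for
  -- `d`; associativity identifies the remainders.
  d⋆one≈G : ∀ n → (d ⋆ one) n ≈ G n
  d⋆one≈G n = ∙-cancelʳ ((d ⋆ (ω ⋆ G)) n) _ _ (begin
    (d ⋆ one) n ⊕ (d ⋆ (ω ⋆ G)) n           ≈⟨ ≈-sym (⋆-distribˡ d one (ω ⋆ G) n) ⟩
    (d ⋆ (λ j → one j ⊕ (ω ⋆ G) j)) n       ≈⟨ ⋆-cong (λ _ → ≈-refl) (λ j → ≈-sym (G-recurrence j)) n ⟩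
    (d ⋆ G) n                               ≈⟨ ⋆-cong d-recurrence (λ _ → ≈-refl) n ⟩
    ((λ k → ε k ⊕ (d ⋆ ω) k) ⋆ G) n         ≈⟨ ⋆-distribʳ ε (d ⋆ ω) G n ⟩
    (ε ⋆ G) n ⊕ ((d ⋆ ω) ⋆ G) n             ≈⟨ ⊕-cong (⋆-identityˡ G n) (≈-sym (⋆-assoc d ω G n)) ⟩
    G n ⊕ (d ⋆ (ω ⋆ G)) n                   ∎)

  A≈G : ∀ n → A R n t 1# q ≈ G n
  A≈G n = ≈-trans (A≈P t n) (≈-trans (P-derangements false t^_ n) (≈-trans
    (∑²-cong n (λ k j _ → ⊗-congˡ (≈-trans
      (∑-cong (der k) (λ {δ} _ → ⊗-congʳ (≈-reflexive (cong t^_ (+-identityʳ (bars false δ))))))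
      (≈-sym (⊗-identityʳ _)))))
    (d⋆one≈G n)))

theorem1p4 : ∀ {c ℓ} (R : CommutativeRing c ℓ) (n : ℕ) → 1 ≤ n →
    (t q : CommutativeRing.Carrier R) →
    CommutativeRing._≈_ R (A R n t (CommutativeRing.1# R) q) (gammaSide R n t q)
theorem1p4 R (suc n) _ t q =
  CommutativeRing.trans R (Main.A≈G R t q (suc n)) (CommutativeRing.sym R (GammaExpansion.gammaSide≈G R t q n))
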